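{- Every algebraic theory $\mathbb{T}$ admits a classifying category: there is a monoidal category $\mathbf{T}$ together with equivalences of categories $\hom(\mathbf{T},\mathbf{C})\simeq\mathrm{Mod}(\mathbb{T},\mathbf{C})$, natural in the monoidal category $\mathbf{C}$.
   Context: Algebraic languages: fix a finitary many-sorted signature $\Sigma$ (atomic types; functional constants $f\colon B_1,\dots,B_n\to B_{n+1}$). Types are finite sequences of atomic types (juxtaposition; $\emptyset$ empty). Raw terms: $t::=\emptyset\mid x\mid f(t_1,\dots,t_n)\mid tt$, tensor associative with unit $\emptyset$; $t[s/x]$ is simultaneous substitution of $s=s_1\dots s_n$ for distinct atomic variables $x=x_1\dots x_n$. Sequents $x:A\vdash t:B$ with $x$ distinct atomic variables. Term calculus: Variables $x:A\vdash x:A$ ($x,A$ atomic); Functions: from $x_i:A_i\vdash t_i:B_i$ infer $x_1\dots x_n:A_1\dots A_n\vdash f(t_1,\dots,t_n):B_{n+1}$; Substitution: from $x:A\vdash s:B$, $y:B\vdash t:C$ infer $x:A\vdash t[s/y]:C$; Unit $\emptyset:\emptyset\vdash\emptyset:\emptyset$; Tensor: from $x:A\vdash s:B$, $y:C\vdash t:D$ infer $xy:AC\vdash st:BD$; Weakening: from $x_1x_3:A_1A_3\vdash t:B$ infer $x_1x_2x_3:A_1A_2A_3\vdash t:B$; Exchange: from $x:A\vdash t:B$ infer $\sigma x:\sigma A\vdash t:B$; Contraction: from $x_1xx'x_2:A_1AAA_2\vdash t:B$ infer $x_1xx_2:A_1AA_2\vdash t[x/x']:B$. An algebraic language $L$ is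 $\Sigma$ plus a subset of {weakening, exchange, contraction}; its terms are the sequents derivable with all non-structural rules and its structural rules. Theories: an $L$-formula is $x:A\vdash t_1=_Bt_2$ with both $x:A\vdash t_i:B$ terms of $L$. The deduction calculus of $L$ consists of reflexivity, symmetry, transitivity of $=$; substitution (from $x:A\vdash s=_Bs'$ and $y:B\vdash t=_Ct'$ infer $x:A\vdash t[s/y]=_Ct'[s'/y]$); tensor (from $x:A\vdash s=_Ss'$, $y:B\vdash t=_Tt'$ infer $xy:AB\vdash st=_{ST}s't'$); and the structural rules of $L$ applied to formulas (to both sides simultaneously). An algebraic theory $\mathbb{T}$ is an algebraic language $L$ with a set of $L$-formulas (axioms); its theorems are the formulas deducible from the axioms. Semantics: in a monoidal category $\mathbf{C}$, an $L$-prestructure assigns objects $|A|$ to atomic types (extended by tensor, $|\emptyset|=1$), arrows $|f|\colon|B_1|\dots|B_n|\to|B_{n+1}|$, and for the structural rules of $L$ arrows $\pi_A\colon|A|\to1$, $\sigma_A\colon|\sigma A|\to|A|$, $\Delta_A\colon|A|\to|AA|$ for all types $A$. Derivations of terms are interpreted inductively (variables as identities, functions as tensor followed by $|f|$, substitution as composition, tensor as tensor, structural rules as precomposition with $1\pi_A1$, $\sigma_A$, $1\Delta_A1$, coherence isomorphisms inserted as needed); an $L$-structure is a prestructure whose interpretation of every term is independent of the derivation. A morphism $h\colon M\to N$: arrows $h_A\colon|A|_M\to|A|_N$ for atomic $A$, extended by tensor, commuting with the interpretations of all terms. $M$ satisfies $x:A\vdash s=_Bt$ iff $|s|_M=|t|_M$;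 a $\mathbb{T}$-model is an $L$-structure satisfying all axioms; $\mathrm{Mod}(\mathbb{T},\mathbf{C})$ is the full subcategory of models. $\hom(\mathbf{T},\mathbf{C})$ is the category of strong monoidal functors and monoidal natural transformations; a strong monoidal functor $F\colon\mathbf{C}\to\mathbf{D}$ induces $\mathrm{Mod}(\mathbb{T},\mathbf{C})\to\mathrm{Mod}(\mathbb{T},\mathbf{D})$ by applying $F$ to all interpreting objects and arrows and correcting by the coherence isomorphisms of $F$ (and monoidal transformations induce morphisms of models); naturality in $\mathbf{C}$ refers to this 2-functoriality. -}

module Defs where

open import Relation.Binary using (Rel; IsEquivalence; Setoid)
open import Level using (Level; _⊔_; Setω) renaming (suc to lsuc; zero to lzero)
open import Data.Nat using (ℕ; _≟_)
open import Data.Bool using (Bool; T)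
open import Data.Fin using (Fin)
open import Data.List using (List; []; _∷_; _++_; [_]; length; zip; map; tabulate; lookup)
open import Data.List.Relation.Unary.Unique.Propositional using (Unique)
open import Data.Maybe using (Maybe; just; nothing)
open import Data.Product using (_×_; _,_)
open import Relation.Nullary using (yes; no)
import Relation.Binary.PropositionalEquality as P
open P using (_≡_)

record Category (o ℓ e : Level) : Set (lsuc (o ⊔ ℓ ⊔ e)) where
  infix  4 _≈_ _⇒_
  infixr 9 _∘_
  field
    Obj : Set o
    _⇒_ : Obj → Obj → Set ℓ
    _≈_ : ∀ {A B} → Rel (A ⇒ B) e
    id  : ∀ {A} → A ⇒ A
    _∘_ : ∀ {A B C} → B ⇒ C → A ⇒ B → A ⇒ C
    equiv : ∀ {A B} → IsEquivalence (_≈_ {A} {B})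
    assoc : ∀ {A B C D} {f : A ⇒ B} {g : B ⇒ C} {h : C ⇒ D} →
            (h ∘ g) ∘ f ≈ h ∘ (g ∘ f)
    identityˡ : ∀ {A B} {f : A ⇒ B} → id ∘ f ≈ f
    identityʳ : ∀ {A B} {f : A ⇒ B} → f ∘ id ≈ f
    ∘-resp-≈ : ∀ {A B C} {f h : B ⇒ C} {g i : A ⇒ B} →
               f ≈ h → g ≈ i → f ∘ g ≈ h ∘ i

  hom-setoid : ∀ {A B} → Setoid ℓ e
  hom-setoid {A} {B} = record { Carrier = A ⇒ B ; _≈_ = _≈_ ; isEquivalence = equiv }

  module Equiv {A B : Obj} = IsEquivalence (equiv {A} {B})

  module HomReasoning {A B : Obj} where
    open import Relation.Binary.Reasoning.Setoid (hom-setoid {A} {B}) public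

  infixr 4 _⟩∘⟨_
  _⟩∘⟨_ : ∀ {A B C} {f h : B ⇒ C} {g i : A ⇒ B} → f ≈ h → g ≈ i → f ∘ g ≈ h ∘ i
  _⟩∘⟨_ = ∘-resp-≈

  refl⟩∘⟨_ : ∀ {A B C} {f : B ⇒ C} {g i : A ⇒ B} → g ≈ i → f ∘ g ≈ f ∘ i
  refl⟩∘⟨ p = ∘-resp-≈ Equiv.refl p

  _⟩∘⟨refl : ∀ {A B C} {f h : B ⇒ C} {g : A ⇒ B} → f ≈ h → f ∘ g ≈ h ∘ g
  p ⟩∘⟨refl = ∘-resp-≈ p Equiv.refl

  infixr 5 refl⟩∘⟨_
  infix 6 _⟩∘⟨refl

  sym-assoc : ∀ {A B C D} {f : A ⇒ B} {g : B ⇒ C} {h : C ⇒ D} →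
              h ∘ (g ∘ f) ≈ (h ∘ g) ∘ f
  sym-assoc = Equiv.sym assoc

  pullˡ : ∀ {A B C D} {g : C ⇒ D} {f : B ⇒ C} {k : B ⇒ D} {x : A ⇒ B} →
          g ∘ f ≈ k → g ∘ (f ∘ x) ≈ k ∘ x
  pullˡ p = Equiv.trans sym-assoc (p ⟩∘⟨refl)

  pushˡ : ∀ {A B C D} {g : C ⇒ D} {f : B ⇒ C} {k : B ⇒ D} {x : A ⇒ B} →
          k ≈ g ∘ f → k ∘ x ≈ g ∘ (f ∘ x)
  pushˡ p = Equiv.trans (p ⟩∘⟨refl) assoc

  id-unique : ∀ {A B} {f : A ⇒ B} → f ≈ id ∘ f
  id-unique = Equiv.sym identityˡ

record Monoidal {o ℓ e} (C : Category o ℓ e) : Set (o ⊔ ℓ ⊔ e) where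
  open Category C
  infixr 10 _⊗₀_ _⊗₁_
  field
    _⊗₀_ : Obj → Obj → Obj
    _⊗₁_ : ∀ {A B X Y} → A ⇒ B → X ⇒ Y → (A ⊗₀ X) ⇒ (B ⊗₀ Y)
    unit : Obj
    ⊗-id : ∀ {A B} → id {A} ⊗₁ id {B} ≈ id
    ⊗-∘ : ∀ {A B C X Y Z} {f : B ⇒ C} {g : A ⇒ B} {h : Y ⇒ Z} {i : X ⇒ Y} →
          (f ∘ g) ⊗₁ (h ∘ i) ≈ (f ⊗₁ h) ∘ (g ⊗₁ i)
    ⊗-resp-≈ : ∀ {A B X Y} {f f' : A ⇒ B} {g g' : X ⇒ Y} →
               f ≈ f' → g ≈ g' → f ⊗₁ g ≈ f' ⊗₁ g'
    α⇒ : ∀ {X Y Z} → (X ⊗₀ Y) ⊗₀ Z ⇒ X ⊗₀ (Y ⊗₀ Z)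
    α⇐ : ∀ {X Y Z} → X ⊗₀ (Y ⊗₀ Z) ⇒ (X ⊗₀ Y) ⊗₀ Z
    α-isoˡ : ∀ {X Y Z} → α⇐ ∘ α⇒ ≈ id {(X ⊗₀ Y) ⊗₀ Z}
    α-isoʳ : ∀ {X Y Z} → α⇒ ∘ α⇐ ≈ id {X ⊗₀ (Y ⊗₀ Z)}
    α-natural : ∀ {A B C X Y Z} {f : A ⇒ X} {g : B ⇒ Y} {h : C ⇒ Z} →
                α⇒ ∘ ((f ⊗₁ g) ⊗₁ h) ≈ (f ⊗₁ (g ⊗₁ h)) ∘ α⇒
    l⇒ : ∀ {X} → unit ⊗₀ X ⇒ X
    l⇐ : ∀ {X} → X ⇒ unit ⊗₀ X
    l-isoˡ : ∀ {X} → l⇐ ∘ l⇒ ≈ id {unit ⊗₀ X}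
    l-isoʳ : ∀ {X} → l⇒ ∘ l⇐ ≈ id {X}
    l-natural : ∀ {X Y} {f : X ⇒ Y} → l⇒ ∘ (id ⊗₁ f) ≈ f ∘ l⇒
    r⇒ : ∀ {X} → X ⊗₀ unit ⇒ X
    r⇐ : ∀ {X} → X ⇒ X ⊗₀ unit
    r-isoˡ : ∀ {X} → r⇐ ∘ r⇒ ≈ id {X ⊗₀ unit}
    r-isoʳ : ∀ {X} → r⇒ ∘ r⇐ ≈ id {X}
    r-natural : ∀ {X Y} {f : X ⇒ Y} → r⇒ ∘ (f ⊗₁ id) ≈ f ∘ r⇒
    triangle : ∀ {X Y} → (id {X} ⊗₁ l⇒ {Y}) ∘ α⇒ ≈ r⇒ ⊗₁ id {Y}
    pentagon : ∀ {W X Y Z} →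
               (id {W} ⊗₁ α⇒ {X} {Y} {Z}) ∘ α⇒ {W} {X ⊗₀ Y} {Z} ∘ (α⇒ {W} {X} {Y} ⊗₁ id {Z})
               ≈ α⇒ {W} {X} {Y ⊗₀ Z} ∘ α⇒ {W ⊗₀ X} {Y} {Z}

record MonCat (o ℓ e : Level) : Set (lsuc (o ⊔ ℓ ⊔ e)) where
  field
    cat : Category o ℓ e
    mon : Monoidal cat
  open Category cat public
  open Monoidal mon public

record SMFunctor {o ℓ e o' ℓ' e'} (C : MonCat o ℓ e) (D : MonCat o' ℓ' e')
       : Set (o ⊔ ℓ ⊔ e ⊔ o' ⊔ ℓ' ⊔ e') where
  private
    module C = MonCat C
    module D = MonCat D
  field
    F₀ : C.Obj → D.Obj
    F₁ : ∀ {A B} → A C.⇒ B → F₀ A D.⇒ F₀ B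
    F-resp-≈ : ∀ {A B} {f g : A C.⇒ B} → f C.≈ g → F₁ f D.≈ F₁ g
    F-id : ∀ {A} → F₁ (C.id {A}) D.≈ D.id
    F-∘ : ∀ {A B X} {f : A C.⇒ B} {g : B C.⇒ X} → F₁ (g C.∘ f) D.≈ F₁ g D.∘ F₁ f
    φ : ∀ {X Y} → F₀ X D.⊗₀ F₀ Y D.⇒ F₀ (X C.⊗₀ Y)
    φ⁻¹ : ∀ {X Y} → F₀ (X C.⊗₀ Y) D.⇒ F₀ X D.⊗₀ F₀ Y
    φ-isoˡ : ∀ {X Y} → φ⁻¹ D.∘ φ D.≈ D.id {F₀ X D.⊗₀ F₀ Y}
    φ-isoʳ : ∀ {X Y} → φ D.∘ φ⁻¹ D.≈ D.id {F₀ (X C.⊗₀ Y)}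
    φ-natural : ∀ {A B X Y} {f : A C.⇒ X} {g : B C.⇒ Y} →
                φ D.∘ (F₁ f D.⊗₁ F₁ g) D.≈ F₁ (f C.⊗₁ g) D.∘ φ
    ε : D.unit D.⇒ F₀ C.unit
    ε⁻¹ : F₀ C.unit D.⇒ D.unit
    ε-isoˡ : ε⁻¹ D.∘ ε D.≈ D.id
    ε-isoʳ : ε D.∘ ε⁻¹ D.≈ D.id
    φ-assoc : ∀ {X Y Z} →
              F₁ (C.α⇒ {X} {Y} {Z}) D.∘ φ D.∘ (φ D.⊗₁ D.id)
              D.≈ φ D.∘ (D.id D.⊗₁ φ) D.∘ D.α⇒
    φ-unitˡ : ∀ {X} → F₁ (C.l⇒ {X}) D.∘ φ D.∘ (ε D.⊗₁ D.id) D.≈ D.l⇒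
    φ-unitʳ : ∀ {X} → F₁ (C.r⇒ {X}) D.∘ φ D.∘ (D.id D.⊗₁ ε) D.≈ D.r⇒

record MonNat {o ℓ e o' ℓ' e'} {C : MonCat o ℓ e} {D : MonCat o' ℓ' e'}
       (F G : SMFunctor C D) : Set (o ⊔ ℓ ⊔ e ⊔ o' ⊔ ℓ' ⊔ e') where
  private
    module C = MonCat C
    module D = MonCat D
    module F = SMFunctor F
    module G = SMFunctor G
  field
    η : ∀ X → F.F₀ X D.⇒ G.F₀ X
    natural : ∀ {X Y} {f : X C.⇒ Y} → η Y D.∘ F.F₁ f D.≈ G.F₁ f D.∘ η X
    monoidal : ∀ {X Y} → η (X C.⊗₀ Y) D.∘ F.φ D.≈ G.φ D.∘ (η X D.⊗₁ η Y)
    monoidal-unit : η C.unit D.∘ F.ε D.≈ G.ε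

module _ {o ℓ e o' ℓ' e' o'' ℓ'' e''} {C : MonCat o ℓ e} {D : MonCat o' ℓ' e'}
         {E : MonCat o'' ℓ'' e''} where
  private
    module C = MonCat C
    module D = MonCat D
  open MonCat E

  infixr 9 _∘SM_
  _∘SM_ : SMFunctor D E → SMFunctor C D → SMFunctor C E
  G ∘SM F = record
    { F₀ = λ X → G.F₀ (F.F₀ X)
    ; F₁ = λ f → G.F₁ (F.F₁ f)
    ; F-resp-≈ = λ p → G.F-resp-≈ (F.F-resp-≈ p)
    ; F-id = Equiv.trans (G.F-resp-≈ F.F-id) G.F-id
    ; F-∘ = Equiv.trans (G.F-resp-≈ F.F-∘) G.F-∘
    ; φ = G.F₁ F.φ ∘ G.φ
    ; φ⁻¹ = G.φ⁻¹ ∘ G.F₁ F.φ⁻¹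
    ; φ-isoˡ = cancelInner (GF≈id F.φ-isoˡ) G.φ-isoˡ
    ; φ-isoʳ = cancelInner G.φ-isoʳ (GF≈id F.φ-isoʳ)
    ; φ-natural = φnat
    ; ε = G.F₁ F.ε ∘ G.ε
    ; ε⁻¹ = G.ε⁻¹ ∘ G.F₁ F.ε⁻¹
    ; ε-isoˡ = cancelInner (GF≈id F.ε-isoˡ) G.ε-isoˡ
    ; ε-isoʳ = cancelInner G.ε-isoʳ (GF≈id F.ε-isoʳ)
    ; φ-assoc = φassoc
    ; φ-unitˡ = φunitˡ
    ; φ-unitʳ = φunitʳ
    }
    where
    module F = SMFunctor F
    module G = SMFunctor G
    open HomReasoning

    GF≈id : ∀ {X Y} {f : Y D.⇒ X} {g : X D.⇒ Y} → f D.∘ g D.≈ D.id → G.F₁ f ∘ G.F₁ g ≈ id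
    GF≈id p = Equiv.trans (Equiv.sym G.F-∘) (Equiv.trans (G.F-resp-≈ p) G.F-id)

    cancelInner : ∀ {A B X} {a : B ⇒ A} {b : X ⇒ B} {c : B ⇒ X} {d : A ⇒ B} →
                  b ∘ c ≈ id → a ∘ d ≈ id → (a ∘ b) ∘ (c ∘ d) ≈ id
    cancelInner {a = a} {b} {c} {d} p q = begin
      (a ∘ b) ∘ (c ∘ d) ≈⟨ assoc ⟩
      a ∘ (b ∘ (c ∘ d)) ≈⟨ refl⟩∘⟨ sym-assoc ⟩
      a ∘ ((b ∘ c) ∘ d) ≈⟨ refl⟩∘⟨ p ⟩∘⟨refl ⟩
      a ∘ (id ∘ d)      ≈⟨ refl⟩∘⟨ identityˡ ⟩
      a ∘ d             ≈⟨ q ⟩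
      id                ∎

    natTail : ∀ {A B X Y W} {x : A D.⇒ X} {y : B D.⇒ Y} {R : W ⇒ G.F₀ A ⊗₀ G.F₀ B} →
              G.φ ∘ ((G.F₁ x ⊗₁ G.F₁ y) ∘ R) ≈ G.F₁ (x D.⊗₁ y) ∘ (G.φ ∘ R)
    natTail = Equiv.trans (pullˡ G.φ-natural) assoc

    collapse3 : ∀ {A B X Y W} {x : X D.⇒ Y} {y : B D.⇒ X} {z : A D.⇒ B} {R : W ⇒ G.F₀ A} →
                G.F₁ x ∘ (G.F₁ y ∘ (G.F₁ z ∘ R)) ≈ G.F₁ (x D.∘ y D.∘ z) ∘ R
    collapse3 {x = x} {y} {z} {R} = Equiv.sym (begin
      G.F₁ (x D.∘ y D.∘ z) ∘ R            ≈⟨ Equiv.trans G.F-∘ (refl⟩∘⟨ G.F-∘) ⟩∘⟨refl ⟩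
      (G.F₁ x ∘ (G.F₁ y ∘ G.F₁ z)) ∘ R    ≈⟨ assoc ⟩
      G.F₁ x ∘ ((G.F₁ y ∘ G.F₁ z) ∘ R)    ≈⟨ refl⟩∘⟨ assoc ⟩
      G.F₁ x ∘ (G.F₁ y ∘ (G.F₁ z ∘ R))    ∎)

    idG : ∀ {X} → id {G.F₀ X} ≈ G.F₁ D.id ∘ id
    idG = Equiv.sym (Equiv.trans identityʳ G.F-id)

    S1 : ∀ {A B X Z} {a : B ⇒ X} {b : A ⇒ B} →
         (a ∘ b) ⊗₁ id {G.F₀ Z} ≈ (a ⊗₁ G.F₁ D.id) ∘ (b ⊗₁ id)
    S1 = Equiv.trans (⊗-resp-≈ Equiv.refl idG) ⊗-∘

    S1' : ∀ {A B X Z} {a : B ⇒ X} {b : A ⇒ B} →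
          id {G.F₀ Z} ⊗₁ (a ∘ b) ≈ (G.F₁ D.id ⊗₁ a) ∘ (id ⊗₁ b)
    S1' = Equiv.trans (⊗-resp-≈ idG Equiv.refl) ⊗-∘

    φnat : ∀ {A B X Y} {f : A C.⇒ X} {g : B C.⇒ Y} →
           (G.F₁ F.φ ∘ G.φ) ∘ (G.F₁ (F.F₁ f) ⊗₁ G.F₁ (F.F₁ g))
           ≈ G.F₁ (F.F₁ (f C.⊗₁ g)) ∘ (G.F₁ F.φ ∘ G.φ)
    φnat {f = f} {g} = begin
      (G.F₁ F.φ ∘ G.φ) ∘ (G.F₁ (F.F₁ f) ⊗₁ G.F₁ (F.F₁ g))  ≈⟨ assoc ⟩
      G.F₁ F.φ ∘ (G.φ ∘ (G.F₁ (F.F₁ f) ⊗₁ G.F₁ (F.F₁ g)))  ≈⟨ refl⟩∘⟨ G.φ-natural ⟩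
      G.F₁ F.φ ∘ (G.F₁ (F.F₁ f D.⊗₁ F.F₁ g) ∘ G.φ)         ≈⟨ sym-assoc ⟩
      (G.F₁ F.φ ∘ G.F₁ (F.F₁ f D.⊗₁ F.F₁ g)) ∘ G.φ         ≈⟨ Equiv.sym G.F-∘ ⟩∘⟨refl ⟩
      G.F₁ (F.φ D.∘ (F.F₁ f D.⊗₁ F.F₁ g)) ∘ G.φ            ≈⟨ G.F-resp-≈ F.φ-natural ⟩∘⟨refl ⟩
      G.F₁ (F.F₁ (f C.⊗₁ g) D.∘ F.φ) ∘ G.φ                 ≈⟨ G.F-∘ ⟩∘⟨refl ⟩
      (G.F₁ (F.F₁ (f C.⊗₁ g)) ∘ G.F₁ F.φ) ∘ G.φ            ≈⟨ assoc ⟩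
      G.F₁ (F.F₁ (f C.⊗₁ g)) ∘ (G.F₁ F.φ ∘ G.φ)            ∎

    φassoc : ∀ {X Y Z} →
             G.F₁ (F.F₁ (C.α⇒ {X} {Y} {Z})) ∘ (G.F₁ F.φ ∘ G.φ) ∘ ((G.F₁ F.φ ∘ G.φ) ⊗₁ id)
             ≈ (G.F₁ F.φ ∘ G.φ) ∘ (id ⊗₁ (G.F₁ F.φ ∘ G.φ)) ∘ α⇒
    φassoc = begin
      G.F₁ (F.F₁ C.α⇒) ∘ (G.F₁ F.φ ∘ G.φ) ∘ ((G.F₁ F.φ ∘ G.φ) ⊗₁ id)
        ≈⟨ refl⟩∘⟨ assoc ⟩
      G.F₁ (F.F₁ C.α⇒) ∘ G.F₁ F.φ ∘ G.φ ∘ ((G.F₁ F.φ ∘ G.φ) ⊗₁ id)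
        ≈⟨ refl⟩∘⟨ refl⟩∘⟨ refl⟩∘⟨ S1 ⟩
      G.F₁ (F.F₁ C.α⇒) ∘ G.F₁ F.φ ∘ G.φ ∘ (G.F₁ F.φ ⊗₁ G.F₁ D.id) ∘ (G.φ ⊗₁ id)
        ≈⟨ refl⟩∘⟨ refl⟩∘⟨ natTail ⟩
      G.F₁ (F.F₁ C.α⇒) ∘ G.F₁ F.φ ∘ G.F₁ (F.φ D.⊗₁ D.id) ∘ G.φ ∘ (G.φ ⊗₁ id)
        ≈⟨ collapse3 ⟩
      G.F₁ (F.F₁ C.α⇒ D.∘ F.φ D.∘ (F.φ D.⊗₁ D.id)) ∘ G.φ ∘ (G.φ ⊗₁ id)
        ≈⟨ G.F-resp-≈ F.φ-assoc ⟩∘⟨refl ⟩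
      G.F₁ (F.φ D.∘ (D.id D.⊗₁ F.φ) D.∘ D.α⇒) ∘ G.φ ∘ (G.φ ⊗₁ id)
        ≈⟨ Equiv.sym collapse3 ⟩
      G.F₁ F.φ ∘ G.F₁ (D.id D.⊗₁ F.φ) ∘ G.F₁ D.α⇒ ∘ G.φ ∘ (G.φ ⊗₁ id)
        ≈⟨ refl⟩∘⟨ refl⟩∘⟨ G.φ-assoc ⟩
      G.F₁ F.φ ∘ G.F₁ (D.id D.⊗₁ F.φ) ∘ G.φ ∘ (id ⊗₁ G.φ) ∘ α⇒
        ≈⟨ refl⟩∘⟨ Equiv.sym natTail ⟩
      G.F₁ F.φ ∘ G.φ ∘ (G.F₁ D.id ⊗₁ G.F₁ F.φ) ∘ (id ⊗₁ G.φ) ∘ α⇒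
        ≈⟨ refl⟩∘⟨ refl⟩∘⟨ Equiv.trans sym-assoc (Equiv.sym S1' ⟩∘⟨refl) ⟩
      G.F₁ F.φ ∘ G.φ ∘ (id ⊗₁ (G.F₁ F.φ ∘ G.φ)) ∘ α⇒
        ≈⟨ sym-assoc ⟩
      (G.F₁ F.φ ∘ G.φ) ∘ (id ⊗₁ (G.F₁ F.φ ∘ G.φ)) ∘ α⇒
        ∎

    φunitˡ : ∀ {X} →
             G.F₁ (F.F₁ (C.l⇒ {X})) ∘ (G.F₁ F.φ ∘ G.φ) ∘ ((G.F₁ F.ε ∘ G.ε) ⊗₁ id) ≈ l⇒
    φunitˡ = begin
      G.F₁ (F.F₁ C.l⇒) ∘ (G.F₁ F.φ ∘ G.φ) ∘ ((G.F₁ F.ε ∘ G.ε) ⊗₁ id)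
        ≈⟨ refl⟩∘⟨ assoc ⟩
      G.F₁ (F.F₁ C.l⇒) ∘ G.F₁ F.φ ∘ G.φ ∘ ((G.F₁ F.ε ∘ G.ε) ⊗₁ id)
        ≈⟨ refl⟩∘⟨ refl⟩∘⟨ refl⟩∘⟨ S1 ⟩
      G.F₁ (F.F₁ C.l⇒) ∘ G.F₁ F.φ ∘ G.φ ∘ (G.F₁ F.ε ⊗₁ G.F₁ D.id) ∘ (G.ε ⊗₁ id)
        ≈⟨ refl⟩∘⟨ refl⟩∘⟨ natTail ⟩
      G.F₁ (F.F₁ C.l⇒) ∘ G.F₁ F.φ ∘ G.F₁ (F.ε D.⊗₁ D.id) ∘ G.φ ∘ (G.ε ⊗₁ id)
        ≈⟨ collapse3 ⟩
      G.F₁ (F.F₁ C.l⇒ D.∘ F.φ D.∘ (F.ε D.⊗₁ D.id)) ∘ G.φ ∘ (G.ε ⊗₁ id)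
        ≈⟨ G.F-resp-≈ F.φ-unitˡ ⟩∘⟨refl ⟩
      G.F₁ D.l⇒ ∘ G.φ ∘ (G.ε ⊗₁ id)
        ≈⟨ G.φ-unitˡ ⟩
      l⇒ ∎

    φunitʳ : ∀ {X} →
             G.F₁ (F.F₁ (C.r⇒ {X})) ∘ (G.F₁ F.φ ∘ G.φ) ∘ (id ⊗₁ (G.F₁ F.ε ∘ G.ε)) ≈ r⇒
    φunitʳ = begin
      G.F₁ (F.F₁ C.r⇒) ∘ (G.F₁ F.φ ∘ G.φ) ∘ (id ⊗₁ (G.F₁ F.ε ∘ G.ε))
        ≈⟨ refl⟩∘⟨ assoc ⟩
      G.F₁ (F.F₁ C.r⇒) ∘ G.F₁ F.φ ∘ G.φ ∘ (id ⊗₁ (G.F₁ F.ε ∘ G.ε))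
        ≈⟨ refl⟩∘⟨ refl⟩∘⟨ refl⟩∘⟨ S1' ⟩
      G.F₁ (F.F₁ C.r⇒) ∘ G.F₁ F.φ ∘ G.φ ∘ (G.F₁ D.id ⊗₁ G.F₁ F.ε) ∘ (id ⊗₁ G.ε)
        ≈⟨ refl⟩∘⟨ refl⟩∘⟨ natTail ⟩
      G.F₁ (F.F₁ C.r⇒) ∘ G.F₁ F.φ ∘ G.F₁ (D.id D.⊗₁ F.ε) ∘ G.φ ∘ (id ⊗₁ G.ε)
        ≈⟨ collapse3 ⟩
      G.F₁ (F.F₁ C.r⇒ D.∘ F.φ D.∘ (D.id D.⊗₁ F.ε)) ∘ G.φ ∘ (id ⊗₁ G.ε)
        ≈⟨ G.F-resp-≈ F.φ-unitʳ ⟩∘⟨refl ⟩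
      G.F₁ D.r⇒ ∘ G.φ ∘ (id ⊗₁ G.ε)
        ≈⟨ G.φ-unitʳ ⟩
      r⇒ ∎

module _ {o ℓ e o' ℓ' e' o'' ℓ'' e''} {B : MonCat o ℓ e} {C : MonCat o' ℓ' e'}
         {D : MonCat o'' ℓ'' e''} where
  private
    module B = MonCat B
    module C = MonCat C
  open MonCat D

  _◁_ : (F : SMFunctor C D) {G G' : SMFunctor B C} → MonNat G G' → MonNat (F ∘SM G) (F ∘SM G')
  _◁_ F {G} {G'} τ = record
    { η = λ X → F.F₁ (τ.η X)
    ; natural = λ {X} {Y} {f} → begin
        F.F₁ (τ.η Y) ∘ F.F₁ (G.F₁ f)   ≈⟨ Equiv.sym F.F-∘ ⟩
        F.F₁ (τ.η Y C.∘ G.F₁ f)        ≈⟨ F.F-resp-≈ τ.natural ⟩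
        F.F₁ (G'.F₁ f C.∘ τ.η X)       ≈⟨ F.F-∘ ⟩
        F.F₁ (G'.F₁ f) ∘ F.F₁ (τ.η X)  ∎
    ; monoidal = λ {X} {Y} → begin
        F.F₁ (τ.η (X B.⊗₀ Y)) ∘ (F.F₁ G.φ ∘ F.φ)       ≈⟨ sym-assoc ⟩
        (F.F₁ (τ.η (X B.⊗₀ Y)) ∘ F.F₁ G.φ) ∘ F.φ       ≈⟨ Equiv.sym F.F-∘ ⟩∘⟨refl ⟩
        F.F₁ (τ.η (X B.⊗₀ Y) C.∘ G.φ) ∘ F.φ            ≈⟨ F.F-resp-≈ τ.monoidal ⟩∘⟨refl ⟩
        F.F₁ (G'.φ C.∘ (τ.η X C.⊗₁ τ.η Y)) ∘ F.φ       ≈⟨ F.F-∘ ⟩∘⟨refl ⟩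
        (F.F₁ G'.φ ∘ F.F₁ (τ.η X C.⊗₁ τ.η Y)) ∘ F.φ    ≈⟨ assoc ⟩
        F.F₁ G'.φ ∘ (F.F₁ (τ.η X C.⊗₁ τ.η Y) ∘ F.φ)    ≈⟨ refl⟩∘⟨ Equiv.sym F.φ-natural ⟩
        F.F₁ G'.φ ∘ (F.φ ∘ (F.F₁ (τ.η X) ⊗₁ F.F₁ (τ.η Y))) ≈⟨ sym-assoc ⟩
        (F.F₁ G'.φ ∘ F.φ) ∘ (F.F₁ (τ.η X) ⊗₁ F.F₁ (τ.η Y)) ∎
    ; monoidal-unit = begin
        F.F₁ (τ.η B.unit) ∘ (F.F₁ G.ε ∘ F.ε)   ≈⟨ sym-assoc ⟩
        (F.F₁ (τ.η B.unit) ∘ F.F₁ G.ε) ∘ F.ε   ≈⟨ Equiv.sym F.F-∘ ⟩∘⟨refl ⟩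
        F.F₁ (τ.η B.unit C.∘ G.ε) ∘ F.ε        ≈⟨ F.F-resp-≈ τ.monoidal-unit ⟩∘⟨refl ⟩
        F.F₁ G'.ε ∘ F.ε                        ∎
    }
    where
    module F = SMFunctor F
    module G = SMFunctor G
    module G' = SMFunctor G'
    module τ = MonNat τ
    open HomReasoning

  _▷_ : {F F' : SMFunctor C D} → MonNat F F' → (H : SMFunctor B C) → MonNat (F ∘SM H) (F' ∘SM H)
  _▷_ {F} {F'} θ H = record
    { η = λ X → θ.η (H.F₀ X)
    ; natural = θ.natural
    ; monoidal = λ {X} {Y} → begin
        θ.η (H.F₀ (X B.⊗₀ Y)) ∘ (F.F₁ H.φ ∘ F.φ)      ≈⟨ sym-assoc ⟩
        (θ.η (H.F₀ (X B.⊗₀ Y)) ∘ F.F₁ H.φ) ∘ F.φ      ≈⟨ θ.natural ⟩∘⟨refl ⟩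
        (F'.F₁ H.φ ∘ θ.η (H.F₀ X C.⊗₀ H.F₀ Y)) ∘ F.φ  ≈⟨ assoc ⟩
        F'.F₁ H.φ ∘ (θ.η (H.F₀ X C.⊗₀ H.F₀ Y) ∘ F.φ)  ≈⟨ refl⟩∘⟨ θ.monoidal ⟩
        F'.F₁ H.φ ∘ (F'.φ ∘ (θ.η (H.F₀ X) ⊗₁ θ.η (H.F₀ Y))) ≈⟨ sym-assoc ⟩
        (F'.F₁ H.φ ∘ F'.φ) ∘ (θ.η (H.F₀ X) ⊗₁ θ.η (H.F₀ Y)) ∎
    ; monoidal-unit = begin
        θ.η (H.F₀ B.unit) ∘ (F.F₁ H.ε ∘ F.ε)   ≈⟨ sym-assoc ⟩
        (θ.η (H.F₀ B.unit) ∘ F.F₁ H.ε) ∘ F.ε   ≈⟨ θ.natural ⟩∘⟨refl ⟩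
        (F'.F₁ H.ε ∘ θ.η C.unit) ∘ F.ε         ≈⟨ assoc ⟩
        F'.F₁ H.ε ∘ (θ.η C.unit ∘ F.ε)         ≈⟨ refl⟩∘⟨ θ.monoidal-unit ⟩
        F'.F₁ H.ε ∘ F'.ε                       ∎
    }
    where
    module F = SMFunctor F
    module F' = SMFunctor F'
    module H = SMFunctor H
    module θ = MonNat θ
    open HomReasoning

module _ {o ℓ e o' ℓ' e'} (T : MonCat o ℓ e) (C : MonCat o' ℓ' e') where
  private
    module T = MonCat T
  open MonCat C

  HomCat : Category (o ⊔ ℓ ⊔ e ⊔ o' ⊔ ℓ' ⊔ e') (o ⊔ ℓ ⊔ e ⊔ o' ⊔ ℓ' ⊔ e') (o ⊔ e')
  HomCat = record
    { Obj = SMFunctor T C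
    ; _⇒_ = MonNat
    ; _≈_ = λ θ θ' → ∀ X → MonNat.η θ X ≈ MonNat.η θ' X
    ; id = idN
    ; _∘_ = compN
    ; equiv = record { refl = λ _ → Equiv.refl
                     ; sym = λ p X → Equiv.sym (p X)
                     ; trans = λ p q X → Equiv.trans (p X) (q X) }
    ; assoc = λ _ → assoc
    ; identityˡ = λ _ → identityˡ
    ; identityʳ = λ _ → identityʳ
    ; ∘-resp-≈ = λ p q X → ∘-resp-≈ (p X) (q X)
    }
    where
    open HomReasoning
    idN : ∀ {F} → MonNat F F
    idN {F} = record
      { η = λ _ → id
      ; natural = Equiv.trans identityˡ (Equiv.sym identityʳ)
      ; monoidal = Equiv.trans identityˡ (Equiv.sym (Equiv.trans (refl⟩∘⟨ ⊗-id) identityʳ))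
      ; monoidal-unit = identityˡ
      }
    compN : ∀ {F G H} → MonNat G H → MonNat F G → MonNat F H
    compN {F} {G} {H} θ τ = record
      { η = λ X → θ.η X ∘ τ.η X
      ; natural = λ {X} {Y} {f} → begin
          (θ.η Y ∘ τ.η Y) ∘ F.F₁ f  ≈⟨ assoc ⟩
          θ.η Y ∘ (τ.η Y ∘ F.F₁ f)  ≈⟨ refl⟩∘⟨ τ.natural ⟩
          θ.η Y ∘ (G.F₁ f ∘ τ.η X)  ≈⟨ sym-assoc ⟩
          (θ.η Y ∘ G.F₁ f) ∘ τ.η X  ≈⟨ θ.natural ⟩∘⟨refl ⟩
          (H.F₁ f ∘ θ.η X) ∘ τ.η X  ≈⟨ assoc ⟩
          H.F₁ f ∘ (θ.η X ∘ τ.η X)  ∎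
      ; monoidal = λ {X} {Y} → begin
          (θ.η (X T.⊗₀ Y) ∘ τ.η (X T.⊗₀ Y)) ∘ F.φ  ≈⟨ assoc ⟩
          θ.η (X T.⊗₀ Y) ∘ (τ.η (X T.⊗₀ Y) ∘ F.φ)  ≈⟨ refl⟩∘⟨ τ.monoidal ⟩
          θ.η (X T.⊗₀ Y) ∘ (G.φ ∘ (τ.η X ⊗₁ τ.η Y))  ≈⟨ sym-assoc ⟩
          (θ.η (X T.⊗₀ Y) ∘ G.φ) ∘ (τ.η X ⊗₁ τ.η Y)  ≈⟨ θ.monoidal ⟩∘⟨refl ⟩
          (H.φ ∘ (θ.η X ⊗₁ θ.η Y)) ∘ (τ.η X ⊗₁ τ.η Y)  ≈⟨ assoc ⟩
          H.φ ∘ ((θ.η X ⊗₁ θ.η Y) ∘ (τ.η X ⊗₁ τ.η Y))  ≈⟨ refl⟩∘⟨ Equiv.sym ⊗-∘ ⟩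
          H.φ ∘ ((θ.η X ∘ τ.η X) ⊗₁ (θ.η Y ∘ τ.η Y))  ∎
      ; monoidal-unit = begin
          (θ.η T.unit ∘ τ.η T.unit) ∘ F.ε  ≈⟨ assoc ⟩
          θ.η T.unit ∘ (τ.η T.unit ∘ F.ε)  ≈⟨ refl⟩∘⟨ τ.monoidal-unit ⟩
          θ.η T.unit ∘ G.ε                 ≈⟨ θ.monoidal-unit ⟩
          H.ε                              ∎
      }
      where
      module F = SMFunctor F
      module G = SMFunctor G
      module H = SMFunctor H
      module θ = MonNat θ
      module τ = MonNat τ

record Functor {o ℓ e o' ℓ' e'} (A : Category o ℓ e) (B : Category o' ℓ' e')
       : Set (o ⊔ ℓ ⊔ e ⊔ o' ⊔ ℓ' ⊔ e') where
  private
    module A = Category A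
    module B = Category B
  field
    F₀ : A.Obj → B.Obj
    F₁ : ∀ {X Y} → X A.⇒ Y → F₀ X B.⇒ F₀ Y
    F-resp-≈ : ∀ {X Y} {f g : X A.⇒ Y} → f A.≈ g → F₁ f B.≈ F₁ g
    F-id : ∀ {X} → F₁ (A.id {X}) B.≈ B.id
    F-∘ : ∀ {X Y Z} {f : X A.⇒ Y} {g : Y A.⇒ Z} → F₁ (g A.∘ f) B.≈ F₁ g B.∘ F₁ f

record Equivalence {o ℓ e o' ℓ' e'} (A : Category o ℓ e) (B : Category o' ℓ' e')
       : Set (o ⊔ ℓ ⊔ e ⊔ o' ⊔ ℓ' ⊔ e') where
  private
    module A = Category A
    module B = Category B
  field
    Φ : Functor A B
    Ψ : Functor B A
  private
    module Φ = Functor Φ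
    module Ψ = Functor Ψ
  field
    unit : ∀ X → X A.⇒ Ψ.F₀ (Φ.F₀ X)
    unit⁻¹ : ∀ X → Ψ.F₀ (Φ.F₀ X) A.⇒ X
    unit-isoˡ : ∀ X → unit⁻¹ X A.∘ unit X A.≈ A.id
    unit-isoʳ : ∀ X → unit X A.∘ unit⁻¹ X A.≈ A.id
    unit-natural : ∀ {X Y} (f : X A.⇒ Y) → unit Y A.∘ f A.≈ Ψ.F₁ (Φ.F₁ f) A.∘ unit X
    counit : ∀ Y → Φ.F₀ (Ψ.F₀ Y) B.⇒ Y
    counit⁻¹ : ∀ Y → Y B.⇒ Φ.F₀ (Ψ.F₀ Y)
    counit-isoˡ : ∀ Y → counit⁻¹ Y B.∘ counit Y B.≈ B.id
    counit-isoʳ : ∀ Y → counit Y B.∘ counit⁻¹ Y B.≈ B.id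
    counit-natural : ∀ {X Y} (f : X B.⇒ Y) → counit Y B.∘ Φ.F₁ (Ψ.F₁ f) B.≈ f B.∘ counit X


-- Signatures, languages, raw terms

record Signature : Set₁ where
  field
    Sort : Set
    Fun  : Set
    dom  : Fun → List Sort
    cod  : Fun → Sort

record Language : Set₁ where
  field
    sig : Signature
    weakening exchange contraction : Bool
  open Signature sig public

-- A raw term is a finite
-- sequence (tensor, associative with unit ∅ = []) of atoms, an atom being
-- a variable or an application f(t₁,…,tₙ) of a functional constant to
-- raw terms.
data Atom (Fun : Set) : Set where
  var : ℕ → Atom Fun
  app : Fun → List (List (Atom Fun)) → Atom Fun

Tm : Set → Set
Tm Fun = List (Atom Fun)

Subst : Set → Set
Subst Fun = List (ℕ × Atom Fun)

lookupVar : ∀ {Fun} → Subst Fun → ℕ → Maybe (Atom Fun)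
lookupVar [] x = nothing
lookupVar ((y , a) ∷ s) x with x ≟ y
... | yes _ = just a
... | no _ = lookupVar s x

mutual
  substA : ∀ {Fun} → Subst Fun → Atom Fun → Atom Fun
  substA s (var x) with lookupVar s x
  ... | just a = a
  ... | nothing = var x
  substA s (app f ts) = app f (substTs s ts)

  substT : ∀ {Fun} → Subst Fun → Tm Fun → Tm Fun
  substT s [] = []
  substT s (a ∷ t) = substA s a ∷ substT s t

  substTs : ∀ {Fun} → Subst Fun → List (Tm Fun) → List (Tm Fun)
  substTs s [] = []
  substTs s (t ∷ ts) = substT s t ∷ substTs s ts

_[_/_] : ∀ {Fun} → Tm Fun → Tm Fun → List ℕ → Tm Fun
t [ s / x ] = substT (zip x s) t

record Perm (n : ℕ) : Set where
  field
    to   : Fin n → Fin n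
    from : Fin n → Fin n
    from∘to : ∀ i → from (to i) ≡ i
    to∘from : ∀ i → to (from i) ≡ i

permute : ∀ {X : Set} (l : List X) → Perm (length l) → List X
permute l σ = tabulate (λ i → lookup l (Perm.to σ i))

-- Term calculus.  Der x A t B : "x : A ⊢ t : B" is derivable in L.

module Terms (L : Language) where
  open Language L

  mutual
    data Der : List ℕ → List Sort → Tm Fun → List Sort → Set where
      var : ∀ x a → Der [ x ] [ a ] [ var x ] [ a ]
      fun : ∀ f {xs As ts} → Ders xs As ts (dom f) → Unique xs →
            Der xs As [ app f ts ] [ cod f ]
      sub : ∀ {x A s B y C t} → Der x A s B → Der y B t C →
            Der x A (t [ s / y ]) C
      unitᵈ : Der [] [] [] []
      tensor : ∀ {x A s B y C t D} → Der x A s B → Der y C t D → Unique (x ++ y) →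
               Der (x ++ y) (A ++ C) (s ++ t) (B ++ D)
      weak : T weakening → ∀ {x₁ x₂ x₃ A₁ A₂ A₃ t B} →
             length x₁ ≡ length A₁ → length x₂ ≡ length A₂ → Unique (x₁ ++ x₂ ++ x₃) →
             Der (x₁ ++ x₃) (A₁ ++ A₃) t B → Der (x₁ ++ x₂ ++ x₃) (A₁ ++ A₂ ++ A₃) t B
      exch : T exchange → ∀ {x A t B} (σ : Perm (length A)) (p : length x ≡ length A) →
             Der x A t B → Der (permute x (P.subst Perm (P.sym p) σ)) (permute A σ) t B
      contr : T contraction → ∀ {x₁ x x' x₂ A₁ A A₂ t B} →
              length x₁ ≡ length A₁ → length x ≡ length A → length x' ≡ length A →
              Der (x₁ ++ x ++ x' ++ x₂) (A₁ ++ A ++ A ++ A₂) t B →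
              Der (x₁ ++ x ++ x₂) (A₁ ++ A ++ A₂) (t [ map var x / x' ]) B

    data Ders : List ℕ → List Sort → List (Tm Fun) → List Sort → Set where
      []ᵈ : Ders [] [] [] []
      _∷ᵈ_ : ∀ {x A t b xs As ts bs} → Der x A t [ b ] → Ders xs As ts bs →
             Ders (x ++ xs) (A ++ As) (t ∷ ts) (b ∷ bs)

  record Formula : Set where
    field
      ctx : List ℕ
      dom' : List Sort
      cod' : List Sort
      lhs rhs : Tm Fun
      lhs-der : Der ctx dom' lhs cod'
      rhs-der : Der ctx dom' rhs cod'

record Theory : Set₁ where
  field
    lang : Language
    Axiom : Set
    axiom : Axiom → Terms.Formula lang

-- Semantics in a monoidal category

module Semantics (L : Language) {o ℓ e} (𝒞 : MonCat o ℓ e) where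
  open Language L
  open Terms L
  open MonCat 𝒞

  ty : (Sort → Obj) → List Sort → Obj
  ty obj [] = unit
  ty obj (a ∷ []) = obj a
  ty obj (a ∷ b ∷ A) = obj a ⊗₀ ty obj (b ∷ A)

  ct : ∀ obj A B → ty obj A ⊗₀ ty obj B ⇒ ty obj (A ++ B)
  ct obj [] B = l⇒
  ct obj (a ∷ []) [] = r⇒
  ct obj (a ∷ []) (b ∷ B) = id
  ct obj (a ∷ b ∷ A) B = (id ⊗₁ ct obj (b ∷ A) B) ∘ α⇒

  ct⁻¹ : ∀ obj A B → ty obj (A ++ B) ⇒ ty obj A ⊗₀ ty obj B
  ct⁻¹ obj [] B = l⇐
  ct⁻¹ obj (a ∷ []) [] = r⇐
  ct⁻¹ obj (a ∷ []) (b ∷ B) = id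
  ct⁻¹ obj (a ∷ b ∷ A) B = α⇐ ∘ (id ⊗₁ ct⁻¹ obj (b ∷ A) B)

  record PreStructure : Set (o ⊔ ℓ) where
    field
      obj : Sort → Obj
      fn  : ∀ f → ty obj (dom f) ⇒ obj (cod f)
      π   : T weakening → ∀ A → ty obj A ⇒ unit
      σ   : T exchange → ∀ A (s : Perm (length A)) → ty obj (permute A s) ⇒ ty obj A
      Δ   : T contraction → ∀ A → ty obj A ⇒ ty obj (A ++ A)

  module Interp (M : PreStructure) where
    open PreStructure M

    ⟦_⟧ : List Sort → Obj
    ⟦_⟧ = ty obj

    mutual
      ⟦_⟧d : ∀ {x A t B} → Der x A t B → ⟦ A ⟧ ⇒ ⟦ B ⟧
      ⟦ var x a ⟧d = id
      ⟦ fun f ds _ ⟧d = fn f ∘ ⟦ ds ⟧ds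
      ⟦ sub d d' ⟧d = ⟦ d' ⟧d ∘ ⟦ d ⟧d
      ⟦ unitᵈ ⟧d = id
      ⟦ tensor {A = A} {B = B} {C = C} {D = D} d d' _ ⟧d =
        ct obj B D ∘ (⟦ d ⟧d ⊗₁ ⟦ d' ⟧d) ∘ ct⁻¹ obj A C
      ⟦ weak w {A₁ = A₁} {A₂} {A₃} _ _ _ d ⟧d =
        ⟦ d ⟧d ∘ ct obj A₁ A₃ ∘ (id ⊗₁ (l⇒ ∘ (π w A₂ ⊗₁ id)))
               ∘ (id ⊗₁ ct⁻¹ obj A₂ A₃) ∘ ct⁻¹ obj A₁ (A₂ ++ A₃)
      ⟦ exch w {A = A} s _ d ⟧d = ⟦ d ⟧d ∘ σ w A s
      ⟦ contr w {A₁ = A₁} {A} {A₂} _ _ _ d ⟧d =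
        ⟦ d ⟧d ∘ ct obj A₁ (A ++ A ++ A₂)
               ∘ (id ⊗₁ (ct obj A (A ++ A₂) ∘ (id ⊗₁ ct obj A A₂) ∘ α⇒
                         ∘ (ct⁻¹ obj A A ⊗₁ id) ∘ (Δ w A ⊗₁ id) ∘ ct⁻¹ obj A A₂))
               ∘ ct⁻¹ obj A₁ (A ++ A₂)

      ⟦_⟧ds : ∀ {xs As ts bs} → Ders xs As ts bs → ⟦ As ⟧ ⇒ ⟦ bs ⟧
      ⟦ []ᵈ ⟧ds = id
      ⟦ _∷ᵈ_ {A = A} {b = b} {As = As} {bs = bs} d ds ⟧ds =
        ct obj [ b ] bs ∘ (⟦ d ⟧d ⊗₁ ⟦ ds ⟧ds) ∘ ct⁻¹ obj A As

  -- an L-structure: interpretation independent of the derivation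
  IsStructure : PreStructure → Set e
  IsStructure M = ∀ {x A t B} (d d' : Der x A t B) → ⟦ d ⟧d ≈ ⟦ d' ⟧d
    where open Interp M

  Satisfies : PreStructure → Formula → Set e
  Satisfies M φ = ⟦ Formula.lhs-der φ ⟧d ≈ ⟦ Formula.rhs-der φ ⟧d
    where open Interp M

  hext : ∀ {obj₁ obj₂ : Sort → Obj} → (∀ a → obj₁ a ⇒ obj₂ a) → ∀ A → ty obj₁ A ⇒ ty obj₂ A
  hext h [] = id
  hext h (a ∷ []) = h a
  hext h (a ∷ b ∷ A) = h a ⊗₁ hext h (b ∷ A)

  record PreHom (M N : PreStructure) : Set (ℓ ⊔ e) where
    private
      module M = Interp M
      module N = Interp N
    field
      h : ∀ a → PreStructure.obj M a ⇒ PreStructure.obj N a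
      commute : ∀ {x A t B} (d : Der x A t B) → hext h B ∘ M.⟦ d ⟧d ≈ N.⟦ d ⟧d ∘ hext h A

  record PreIso (M N : PreStructure) : Set (ℓ ⊔ e) where
    field
      to : PreHom M N
      from : PreHom N M
      isoˡ : ∀ a → PreHom.h from a ∘ PreHom.h to a ≈ id
      isoʳ : ∀ a → PreHom.h to a ∘ PreHom.h from a ≈ id

  hext-id : ∀ {obj : Sort → Obj} A → hext {obj} {obj} (λ a → id) A ≈ id
  hext-id [] = Equiv.refl
  hext-id (a ∷ []) = Equiv.refl
  hext-id (a ∷ b ∷ A) = Equiv.trans (⊗-resp-≈ Equiv.refl (hext-id (b ∷ A))) ⊗-id

  hext-∘ : ∀ {obj₁ obj₂ obj₃ : Sort → Obj} (g : ∀ a → obj₂ a ⇒ obj₃ a) (f : ∀ a → obj₁ a ⇒ obj₂ a) A →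
           hext (λ a → g a ∘ f a) A ≈ hext g A ∘ hext f A
  hext-∘ g f [] = Equiv.sym identityˡ
  hext-∘ g f (a ∷ []) = Equiv.refl
  hext-∘ g f (a ∷ b ∷ A) = Equiv.trans (⊗-resp-≈ Equiv.refl (hext-∘ g f (b ∷ A))) ⊗-∘

-- Models and the category Mod(𝕋, C)

module _ (Th : Theory) {o ℓ e} (𝒞 : MonCat o ℓ e) where
  open Theory Th
  open Language lang
  open Terms lang
  open Semantics lang 𝒞
  open MonCat 𝒞

  record Model : Set (o ⊔ ℓ ⊔ e) where
    field
      pre : PreStructure
      structure : IsStructure pre
      sat : ∀ i → Satisfies pre (axiom i)

  ModCat : Category (o ⊔ ℓ ⊔ e) (ℓ ⊔ e) e
  ModCat = record
    { Obj = Model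
    ; _⇒_ = λ M N → PreHom (Model.pre M) (Model.pre N)
    ; _≈_ = λ f g → ∀ a → PreHom.h f a ≈ PreHom.h g a
    ; id = λ {M} → idH {M}
    ; _∘_ = λ {M} {N} {K} → compH {M} {N} {K}
    ; equiv = record { refl = λ _ → Equiv.refl
                     ; sym = λ p a → Equiv.sym (p a)
                     ; trans = λ p q a → Equiv.trans (p a) (q a) }
    ; assoc = λ _ → assoc
    ; identityˡ = λ _ → identityˡ
    ; identityʳ = λ _ → identityʳ
    ; ∘-resp-≈ = λ p q a → ∘-resp-≈ (p a) (q a)
    }
    where
    open HomReasoning
    idH : ∀ {M} → PreHom (Model.pre M) (Model.pre M)
    idH {M} = record
      { h = λ a → id
      ; commute = λ {x} {A} {t} {B} d → begin
          hext (λ a → id) B ∘ ⟦ d ⟧d  ≈⟨ hext-id B ⟩∘⟨refl ⟩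
          id ∘ ⟦ d ⟧d                 ≈⟨ identityˡ ⟩
          ⟦ d ⟧d                      ≈⟨ Equiv.sym identityʳ ⟩
          ⟦ d ⟧d ∘ id                 ≈⟨ refl⟩∘⟨ Equiv.sym (hext-id A) ⟩
          ⟦ d ⟧d ∘ hext (λ a → id) A  ∎
      }
      where open Interp (Model.pre M)
    compH : ∀ {M N K} → PreHom (Model.pre N) (Model.pre K) → PreHom (Model.pre M) (Model.pre N)
            → PreHom (Model.pre M) (Model.pre K)
    compH {M} {N} {K} g f = record
      { h = λ a → g.h a ∘ f.h a
      ; commute = λ {x} {A} {t} {B} d → begin
          hext (λ a → g.h a ∘ f.h a) B ∘ M.⟦ d ⟧d    ≈⟨ hext-∘ g.h f.h B ⟩∘⟨refl ⟩
          (hext g.h B ∘ hext f.h B) ∘ M.⟦ d ⟧d       ≈⟨ assoc ⟩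
          hext g.h B ∘ (hext f.h B ∘ M.⟦ d ⟧d)       ≈⟨ refl⟩∘⟨ f.commute d ⟩
          hext g.h B ∘ (N.⟦ d ⟧d ∘ hext f.h A)       ≈⟨ sym-assoc ⟩
          (hext g.h B ∘ N.⟦ d ⟧d) ∘ hext f.h A       ≈⟨ g.commute d ⟩∘⟨refl ⟩
          (K.⟦ d ⟧d ∘ hext g.h A) ∘ hext f.h A       ≈⟨ assoc ⟩
          K.⟦ d ⟧d ∘ (hext g.h A ∘ hext f.h A)       ≈⟨ refl⟩∘⟨ Equiv.sym (hext-∘ g.h f.h A) ⟩
          K.⟦ d ⟧d ∘ hext (λ a → g.h a ∘ f.h a) A    ∎
      }
      where
      module g = PreHom g
      module f = PreHom f
      module M = Interp (Model.pre M)
      module N = Interp (Model.pre N)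
      module K = Interp (Model.pre K)

module Transport (L : Language) {o ℓ e o' ℓ' e'} {C : MonCat o ℓ e} {D : MonCat o' ℓ' e'}
                 (F : SMFunctor C D) where
  open Language L
  private
    module C = MonCat C
    module D = MonCat D
    module SC = Semantics L C
    module SD = Semantics L D
    module F = SMFunctor F

  φext : ∀ (obj : Sort → C.Obj) A → SD.ty (λ a → F.F₀ (obj a)) A D.⇒ F.F₀ (SC.ty obj A)
  φext obj [] = F.ε
  φext obj (a ∷ []) = D.id
  φext obj (a ∷ b ∷ A) = F.φ D.∘ (D.id D.⊗₁ φext obj (b ∷ A))

  φext⁻¹ : ∀ (obj : Sort → C.Obj) A → F.F₀ (SC.ty obj A) D.⇒ SD.ty (λ a → F.F₀ (obj a)) A
  φext⁻¹ obj [] = F.ε⁻¹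
  φext⁻¹ obj (a ∷ []) = D.id
  φext⁻¹ obj (a ∷ b ∷ A) = (D.id D.⊗₁ φext⁻¹ obj (b ∷ A)) D.∘ F.φ⁻¹

  transport : SC.PreStructure → SD.PreStructure
  transport M = record
    { obj = obj'
    ; fn = λ f → F.F₁ (M.fn f) D.∘ φext M.obj (dom f)
    ; π = λ w A → F.ε⁻¹ D.∘ F.F₁ (M.π w A) D.∘ φext M.obj A
    ; σ = λ w A s → φext⁻¹ M.obj A D.∘ F.F₁ (M.σ w A s) D.∘ φext M.obj (permute A s)
    ; Δ = λ w A → φext⁻¹ M.obj (A ++ A) D.∘ F.F₁ (M.Δ w A) D.∘ φext M.obj A
    }
    where
    module M = SC.PreStructure M
    obj' : Sort → D.Obj
    obj' a = F.F₀ (M.obj a)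

-- Classifying categories

module _ (Th : Theory) where
  open Theory Th
  open Language lang

  EquivFamily : MonCat lzero lzero lzero → Setω
  EquivFamily 𝐓 = ∀ {o ℓ e} (C : MonCat o ℓ e) → Equivalence (HomCat 𝐓 C) (ModCat Th C)

  module _ {𝐓 : MonCat lzero lzero lzero} (E : EquivFamily 𝐓) where
    Φ₀ : ∀ {o ℓ e} (C : MonCat o ℓ e) → SMFunctor 𝐓 C → Model Th C
    Φ₀ C = Functor.F₀ (Equivalence.Φ (E C))

    Φ₁ : ∀ {o ℓ e} (C : MonCat o ℓ e) {G G' : SMFunctor 𝐓 C} → MonNat G G' →
         Semantics.PreHom lang C (Model.pre (Φ₀ C G)) (Model.pre (Φ₀ C G'))
    Φ₁ C = Functor.F₁ (Equivalence.Φ (E C))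

    -- naturality of the equivalences in C (w.r.t. strong monoidal functors
    -- F : C → D, and compatibly with monoidal transformations F ⇒ F')
    record PseudoNatural : Setω where
      field
        iso : ∀ {o ℓ e o' ℓ' e'} {C : MonCat o ℓ e} {D : MonCat o' ℓ' e'}
              (F : SMFunctor C D) (G : SMFunctor 𝐓 C) →
              Semantics.PreIso lang D (Transport.transport lang F (Model.pre (Φ₀ C G)))
                                      (Model.pre (Φ₀ D (F ∘SM G)))
        iso-natural : ∀ {o ℓ e o' ℓ' e'} {C : MonCat o ℓ e} {D : MonCat o' ℓ' e'}
              (F : SMFunctor C D) {G G' : SMFunctor 𝐓 C} (τ : MonNat G G') (a : Sort) →
              MonCat._≈_ D
                (MonCat._∘_ D (Semantics.PreHom.h (Semantics.PreIso.to (iso F G')) a)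
                              (SMFunctor.F₁ F (Semantics.PreHom.h (Φ₁ C τ) a)))
                (MonCat._∘_ D (Semantics.PreHom.h (Φ₁ D (F ◁ τ)) a)
                              (Semantics.PreHom.h (Semantics.PreIso.to (iso F G)) a))
        iso-2cell : ∀ {o ℓ e o' ℓ' e'} {C : MonCat o ℓ e} {D : MonCat o' ℓ' e'}
              {F F' : SMFunctor C D} (θ : MonNat F F') (G : SMFunctor 𝐓 C) (a : Sort) →
              MonCat._≈_ D
                (MonCat._∘_ D (Semantics.PreHom.h (Semantics.PreIso.to (iso F' G)) a)
                              (MonNat.η θ (Semantics.PreStructure.obj (Model.pre (Φ₀ C G)) a)))
                (MonCat._∘_ D (Semantics.PreHom.h (Φ₁ D (θ ▷ G)) a)
                              (Semantics.PreHom.h (Semantics.PreIso.to (iso F G)) a))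

  record ClassifyingCategory : Setω where
    field
      𝐓 : MonCat lzero lzero lzero
      equivalence : EquivFamily 𝐓
      natural : PseudoNatural equivalence

{-# OPTIONS --safe #-}
-- 𝐓 is presented by generators and relations. Its objects are formal tensor products of types ⌜ A ⌝,
-- its morphisms are generated by the monoidal structure, isomorphisms ⌜ a ⌝ ⊗ ⌜ b B ⌝ ≅ ⌜ a b B ⌝,
-- a morphism der d for each derivation d and one for each operation of a pre-structure, subject to
-- the monoidal axioms, the unfolding of every derivation along its last rule, the equality of any
-- two derivations of the same sequent, and the axioms of 𝕋. A model therefore interprets 𝐓 by a
-- strict monoidal functor. Conversely, a strong monoidal G : 𝐓 → C induces a model on the objects
-- G ⌜ a ⌝ whose operations are the images of the generators, transferred along the comparison
-- isomorphisms |A| ≅ G ⌜ A ⌝; these are natural, so every derivation d is interpreted by the transfer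
-- of G (der d), and the relations of 𝐓 make the induced structure a model. Each naturality statement
-- is an induction over the morphisms of 𝐓: a property closed under the monoidal structure and true
-- of the generators holds everywhere, the case of der d following from its unfolding. The two
-- constructions are inverse up to the comparison isomorphisms, and applying F : C → D to the model
-- induced by G gives the model induced by F ∘ G up to operations that agree, so all isomorphisms
-- witnessing naturality in C are identities.
module Submission where

open import Defs
open import Level using () renaming (zero to lzero)
open import Data.Bool using (T)
open import Data.Nat using (ℕ; suc; _+_; _<_)
open import Data.Nat.Properties using (+-suc; +-identityʳ; ≤-refl; <⇒≢; m<n⇒m<1+n)
open import Data.List using (List; []; _∷_; _++_; [_]; length; map)
open import Data.List.Properties using (++-identityʳ)
open import Data.List.Relation.Unary.All using (All; []; _∷_)
open import Data.List.Relation.Unary.AllPairs using ([]; _∷_)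
open import Data.List.Relation.Unary.Unique.Propositional using (Unique)
open import Relation.Binary.PropositionalEquality as P using (_≡_; _≢_)

module MonoidalReasoning {o ℓ e} (C : MonCat o ℓ e) where
  open MonCat C public
  open HomReasoning public
  open Equiv public

  id-comm : ∀ {X Y} {f : X ⇒ Y} → f ∘ id ≈ id ∘ f
  id-comm = trans identityʳ (sym identityˡ)

  id-comm-sym : ∀ {X Y} {f : X ⇒ Y} → id ∘ f ≈ f ∘ id
  id-comm-sym = sym id-comm

  cancelˡ : ∀ {X Y Z} {f : Y ⇒ X} {g : X ⇒ Y} {h : Z ⇒ X} → f ∘ g ≈ id → f ∘ (g ∘ h) ≈ h
  cancelˡ p = trans sym-assoc (trans (p ⟩∘⟨refl) identityˡ)

  cancelʳ : ∀ {X Y Z} {f : X ⇒ Z} {g : Y ⇒ X} {h : X ⇒ Y} → g ∘ h ≈ id → (f ∘ g) ∘ h ≈ f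
  cancelʳ p = trans assoc (trans (refl⟩∘⟨ p) identityʳ)

  assoc²' : ∀ {X Y Z U V} {f : U ⇒ V} {g : Z ⇒ U} {h : Y ⇒ Z} {i : X ⇒ Y} →
            (f ∘ g ∘ h) ∘ i ≈ f ∘ g ∘ h ∘ i
  assoc²' = trans assoc (refl⟩∘⟨ assoc)

  assoc³' : ∀ {X Y Z U V W} {f : V ⇒ W} {g : U ⇒ V} {h : Z ⇒ U} {k : Y ⇒ Z} {i : X ⇒ Y} →
            (f ∘ g ∘ h ∘ k) ∘ i ≈ f ∘ g ∘ h ∘ k ∘ i
  assoc³' = trans assoc (refl⟩∘⟨ assoc²')

  split₁ʳ : ∀ {X Y Z U V} {f : Y ⇒ Z} {g : X ⇒ Y} {h : U ⇒ V} → (f ∘ g) ⊗₁ h ≈ (f ⊗₁ h) ∘ (g ⊗₁ id)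
  split₁ʳ = trans (⊗-resp-≈ refl (sym identityʳ)) ⊗-∘

  split₂ʳ : ∀ {X Y Z U V} {f : U ⇒ V} {g : Y ⇒ Z} {h : X ⇒ Y} → f ⊗₁ (g ∘ h) ≈ (f ⊗₁ g) ∘ (id ⊗₁ h)
  split₂ʳ = trans (⊗-resp-≈ (sym identityʳ) refl) ⊗-∘

  serialize₂₁ : ∀ {X Y U V} {f : X ⇒ Y} {g : U ⇒ V} → f ⊗₁ g ≈ (id ⊗₁ g) ∘ (f ⊗₁ id)
  serialize₂₁ = trans (⊗-resp-≈ (sym identityˡ) (sym identityʳ)) ⊗-∘

  serialize₁₂ : ∀ {X Y U V} {f : X ⇒ Y} {g : U ⇒ V} → f ⊗₁ g ≈ (f ⊗₁ id) ∘ (id ⊗₁ g)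
  serialize₁₂ = trans (⊗-resp-≈ (sym identityʳ) (sym identityˡ)) ⊗-∘

  parallel : ∀ {X₁ X₂ Y₁ Y₂ Z₁ Z₂ W₁ W₂} {f₁ : Y₁ ⇒ Z₁} {f₂ : X₁ ⇒ Y₁} {g₁ : W₁ ⇒ Z₁} {g₂ : X₁ ⇒ W₁}
             {h₁ : Y₂ ⇒ Z₂} {h₂ : X₂ ⇒ Y₂} {i₁ : W₂ ⇒ Z₂} {i₂ : X₂ ⇒ W₂} →
             f₁ ∘ f₂ ≈ g₁ ∘ g₂ → h₁ ∘ h₂ ≈ i₁ ∘ i₂ → (f₁ ⊗₁ h₁) ∘ (f₂ ⊗₁ h₂) ≈ (g₁ ⊗₁ i₁) ∘ (g₂ ⊗₁ i₂)
  parallel p q = trans (sym ⊗-∘) (trans (⊗-resp-≈ p q) ⊗-∘)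

  ∘-inverse : ∀ {X Y Z} {f : X ⇒ Y} {f⁻¹ : Y ⇒ X} {g : Y ⇒ Z} {g⁻¹ : Z ⇒ Y} →
              f⁻¹ ∘ f ≈ id → g⁻¹ ∘ g ≈ id → (f⁻¹ ∘ g⁻¹) ∘ (g ∘ f) ≈ id
  ∘-inverse p q = trans assoc (trans (refl⟩∘⟨ cancelˡ q) p)

  ∘-inverse₃ : ∀ {X Y Z W} {f : X ⇒ Y} {f⁻¹ : Y ⇒ X} {g : Y ⇒ Z} {g⁻¹ : Z ⇒ Y} {h : Z ⇒ W} {h⁻¹ : W ⇒ Z} →
               f⁻¹ ∘ f ≈ id → g⁻¹ ∘ g ≈ id → h⁻¹ ∘ h ≈ id → (f⁻¹ ∘ g⁻¹ ∘ h⁻¹) ∘ (h ∘ g ∘ f) ≈ id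
  ∘-inverse₃ p q r = trans assoc²' (trans (refl⟩∘⟨ refl⟩∘⟨ cancelˡ r) (trans (refl⟩∘⟨ cancelˡ q) p))

  ⊗-inverse : ∀ {X Y U V} {f : X ⇒ Y} {f⁻¹ : Y ⇒ X} {g : U ⇒ V} {g⁻¹ : V ⇒ U} →
              f⁻¹ ∘ f ≈ id → g⁻¹ ∘ g ≈ id → (f⁻¹ ⊗₁ g⁻¹) ∘ (f ⊗₁ g) ≈ id
  ⊗-inverse p q = trans (sym ⊗-∘) (trans (⊗-resp-≈ p q) ⊗-id)

  transposeʳ : ∀ {X Y Z} {f : X ⇒ Y} {f⁻¹ : Y ⇒ X} {g : Y ⇒ Z} {h : X ⇒ Z} →
               f ∘ f⁻¹ ≈ id → g ∘ f ≈ h → g ≈ h ∘ f⁻¹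
  transposeʳ p q = trans (sym (cancelʳ p)) (q ⟩∘⟨refl)

  transposeˡ : ∀ {X Y Z} {f : Y ⇒ Z} {f⁻¹ : Z ⇒ Y} {g : X ⇒ Y} {h : X ⇒ Z} →
               f⁻¹ ∘ f ≈ id → f ∘ g ≈ h → g ≈ f⁻¹ ∘ h
  transposeˡ p q = trans (sym (cancelˡ p)) (refl⟩∘⟨ q)

  inverse-square : ∀ {X Y X' Y'} {a : X ⇒ Y} {b : X' ⇒ Y'} {i : X ⇒ X'} {i⁻¹ : X' ⇒ X}
                   {j : Y ⇒ Y'} {j⁻¹ : Y' ⇒ Y} →
                   i ∘ i⁻¹ ≈ id → j⁻¹ ∘ j ≈ id → j ∘ a ≈ b ∘ i → a ∘ i⁻¹ ≈ j⁻¹ ∘ b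
  inverse-square p q s = transposeˡ q (trans sym-assoc (trans (s ⟩∘⟨refl) (cancelʳ p)))

  inverse-unique : ∀ {X Y} {f g : X ⇒ Y} {f⁻¹ g⁻¹ : Y ⇒ X} →
                   f ≈ g → f⁻¹ ∘ f ≈ id → g ∘ g⁻¹ ≈ id → f⁻¹ ≈ g⁻¹
  inverse-unique f≈g p q = trans (transposeʳ q (trans (refl⟩∘⟨ sym f≈g) p)) identityˡ

  l-conjugate : ∀ {X Y} {f : X ⇒ Y} → l⇒ ∘ (id ⊗₁ f) ∘ l⇐ ≈ f
  l-conjugate = trans sym-assoc (trans (l-natural ⟩∘⟨refl) (cancelʳ l-isoʳ))

  r-conjugate : ∀ {X Y} {f : X ⇒ Y} → r⇒ ∘ (f ⊗₁ id) ∘ r⇐ ≈ f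
  r-conjugate = trans sym-assoc (trans (r-natural ⟩∘⟨refl) (cancelʳ r-isoʳ))

module StrongMonoidalReasoning {o ℓ e o' ℓ' e'} {C : MonCat o ℓ e} {D : MonCat o' ℓ' e'}
                               (F : SMFunctor C D) where
  private module C = MonCat C
  open MonoidalReasoning D
  open SMFunctor F public

  F-inverse : ∀ {X Y} {f : Y C.⇒ X} {g : X C.⇒ Y} → f C.∘ g C.≈ C.id → F₁ f ∘ F₁ g ≈ id
  F-inverse p = trans (sym F-∘) (trans (F-resp-≈ p) F-id)

  F-∘₃ : ∀ {X Y Z W} {f : Z C.⇒ W} {g : Y C.⇒ Z} {h : X C.⇒ Y} →
         F₁ (f C.∘ g C.∘ h) ≈ F₁ f ∘ F₁ g ∘ F₁ h
  F-∘₃ = trans F-∘ (refl⟩∘⟨ F-∘)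

  φ⁻¹-natural : ∀ {X Y X' Y'} {f : X C.⇒ X'} {g : Y C.⇒ Y'} →
                φ⁻¹ ∘ F₁ (f C.⊗₁ g) ≈ (F₁ f ⊗₁ F₁ g) ∘ φ⁻¹
  φ⁻¹-natural = sym (inverse-square φ-isoʳ φ-isoˡ φ-natural)

  φ⁻¹-assoc : ∀ {X Y Z} →
              (id ⊗₁ φ⁻¹) ∘ φ⁻¹ ∘ F₁ (C.α⇒ {X} {Y} {Z}) ≈ α⇒ ∘ (φ⁻¹ ⊗₁ id) ∘ φ⁻¹
  φ⁻¹-assoc = begin
    (id ⊗₁ φ⁻¹) ∘ φ⁻¹ ∘ F₁ C.α⇒                                        ≈⟨ refl⟩∘⟨ refl⟩∘⟨ F-α ⟩
    (id ⊗₁ φ⁻¹) ∘ φ⁻¹ ∘ (φ ∘ (id ⊗₁ φ) ∘ α⇒) ∘ (φ⁻¹ ⊗₁ id) ∘ φ⁻¹       ≈⟨ refl⟩∘⟨ refl⟩∘⟨ assoc ⟩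
    (id ⊗₁ φ⁻¹) ∘ φ⁻¹ ∘ φ ∘ ((id ⊗₁ φ) ∘ α⇒) ∘ (φ⁻¹ ⊗₁ id) ∘ φ⁻¹       ≈⟨ refl⟩∘⟨ cancelˡ φ-isoˡ ⟩
    (id ⊗₁ φ⁻¹) ∘ ((id ⊗₁ φ) ∘ α⇒) ∘ (φ⁻¹ ⊗₁ id) ∘ φ⁻¹                 ≈⟨ refl⟩∘⟨ assoc ⟩
    (id ⊗₁ φ⁻¹) ∘ (id ⊗₁ φ) ∘ α⇒ ∘ (φ⁻¹ ⊗₁ id) ∘ φ⁻¹                   ≈⟨ cancelˡ (⊗-inverse identityˡ φ-isoˡ) ⟩
    α⇒ ∘ (φ⁻¹ ⊗₁ id) ∘ φ⁻¹                                             ∎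
    where
    F-α : F₁ C.α⇒ ≈ (φ ∘ (id ⊗₁ φ) ∘ α⇒) ∘ (φ⁻¹ ⊗₁ id) ∘ φ⁻¹
    F-α = transposeʳ (∘-inverse φ-isoʳ (⊗-inverse φ-isoʳ identityˡ)) φ-assoc

  F-l⇒ : ∀ {X} → F₁ (C.l⇒ {X}) ≈ l⇒ ∘ (ε⁻¹ ⊗₁ id) ∘ φ⁻¹
  F-l⇒ = transposeʳ (∘-inverse φ-isoʳ (⊗-inverse ε-isoʳ identityˡ)) φ-unitˡ

  F-r⇒ : ∀ {X} → F₁ (C.r⇒ {X}) ≈ r⇒ ∘ (id ⊗₁ ε⁻¹) ∘ φ⁻¹
  F-r⇒ = transposeʳ (∘-inverse φ-isoʳ (⊗-inverse identityˡ ε-isoʳ)) φ-unitʳ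

module MonNatReasoning {o ℓ e o' ℓ' e'} {C : MonCat o ℓ e} {D : MonCat o' ℓ' e'}
                       {G G' : SMFunctor C D} (τ : MonNat G G') where
  private
    module C = MonCat C
    module G = SMFunctor G
    module G' = SMFunctor G'
  open MonoidalReasoning D
  open MonNat τ public

  monoidal⁻¹ : ∀ {X Y} → G'.φ⁻¹ ∘ η (X C.⊗₀ Y) ≈ (η X ⊗₁ η Y) ∘ G.φ⁻¹
  monoidal⁻¹ = sym (inverse-square G.φ-isoʳ G'.φ-isoˡ (sym monoidal))

  monoidal-unit⁻¹ : G'.ε⁻¹ ∘ η C.unit ≈ G.ε⁻¹
  monoidal-unit⁻¹ = trans (sym (inverse-square G.ε-isoʳ G'.ε-isoˡ (trans identityʳ (sym monoidal-unit)))) identityˡ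

module _ (Th : Theory) where
  open Theory Th
  open Language lang
  open Terms lang

  -- The classifying category

  infixr 10 _⊗_ _⊗M_
  infixr 9 _∘M_
  infix 4 _≈M_

  data Ob : Set where
    ⌜_⌝ : List Sort → Ob
    _⊗_ : Ob → Ob → Ob

  𝟙 : Ob
  𝟙 = ⌜ [] ⌝

  -- cons mirrors the clause  ty obj (a ∷ b ∷ A) = obj a ⊗₀ ty obj (b ∷ A);
  -- ⌜fn⌝, ⌜π⌝, ⌜σ⌝ and ⌜Δ⌝ are the data of a pre-structure, der d the meaning of a derivation.
  data Mor : Ob → Ob → Set where
    idM : ∀ {X} → Mor X X
    _∘M_ : ∀ {X Y Z} → Mor Y Z → Mor X Y → Mor X Z
    _⊗M_ : ∀ {X Y X' Y'} → Mor X Y → Mor X' Y' → Mor (X ⊗ X') (Y ⊗ Y')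
    α⇒M : ∀ {X Y Z} → Mor ((X ⊗ Y) ⊗ Z) (X ⊗ (Y ⊗ Z))
    α⇐M : ∀ {X Y Z} → Mor (X ⊗ (Y ⊗ Z)) ((X ⊗ Y) ⊗ Z)
    l⇒M : ∀ {X} → Mor (𝟙 ⊗ X) X
    l⇐M : ∀ {X} → Mor X (𝟙 ⊗ X)
    r⇒M : ∀ {X} → Mor (X ⊗ 𝟙) X
    r⇐M : ∀ {X} → Mor X (X ⊗ 𝟙)
    cons : ∀ a b A → Mor (⌜ [ a ] ⌝ ⊗ ⌜ b ∷ A ⌝) ⌜ a ∷ b ∷ A ⌝
    cons⁻¹ : ∀ a b A → Mor ⌜ a ∷ b ∷ A ⌝ (⌜ [ a ] ⌝ ⊗ ⌜ b ∷ A ⌝)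
    der : ∀ {x A t B} → Der x A t B → Mor ⌜ A ⌝ ⌜ B ⌝
    ⌜fn⌝ : ∀ f → Mor ⌜ dom f ⌝ ⌜ [ cod f ] ⌝
    ⌜π⌝ : T weakening → ∀ A → Mor ⌜ A ⌝ 𝟙
    ⌜σ⌝ : T exchange → ∀ A (s : Perm (length A)) → Mor ⌜ permute A s ⌝ ⌜ A ⌝
    ⌜Δ⌝ : T contraction → ∀ A → Mor ⌜ A ⌝ ⌜ A ++ A ⌝

  ⌜ct⌝ : ∀ A B → Mor (⌜ A ⌝ ⊗ ⌜ B ⌝) ⌜ A ++ B ⌝
  ⌜ct⌝ [] B = l⇒M
  ⌜ct⌝ (a ∷ []) [] = r⇒M
  ⌜ct⌝ (a ∷ []) (b ∷ B) = cons a b B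
  ⌜ct⌝ (a ∷ b ∷ A) B = cons a b (A ++ B) ∘M (idM ⊗M ⌜ct⌝ (b ∷ A) B) ∘M α⇒M ∘M (cons⁻¹ a b A ⊗M idM)

  ⌜ct⁻¹⌝ : ∀ A B → Mor ⌜ A ++ B ⌝ (⌜ A ⌝ ⊗ ⌜ B ⌝)
  ⌜ct⁻¹⌝ [] B = l⇐M
  ⌜ct⁻¹⌝ (a ∷ []) [] = r⇐M
  ⌜ct⁻¹⌝ (a ∷ []) (b ∷ B) = cons⁻¹ a b B
  ⌜ct⁻¹⌝ (a ∷ b ∷ A) B = (cons a b A ⊗M idM) ∘M α⇐M ∘M (idM ⊗M ⌜ct⁻¹⌝ (b ∷ A) B) ∘M cons⁻¹ a b (A ++ B)

  ders : ∀ {xs As ts bs} → Ders xs As ts bs → Mor ⌜ As ⌝ ⌜ bs ⌝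
  ders []ᵈ = idM
  ders (_∷ᵈ_ {A = A} {b = b} {As = As} {bs = bs} d ds) =
    ⌜ct⌝ [ b ] bs ∘M (der d ⊗M ders ds) ∘M ⌜ct⁻¹⌝ A As

  -- the last rule of a derivation, written as in the clauses of Interp.⟦_⟧d
  unfold : ∀ {x A t B} → Der x A t B → Mor ⌜ A ⌝ ⌜ B ⌝
  unfold (var x a) = idM
  unfold (fun f ds _) = ⌜fn⌝ f ∘M ders ds
  unfold (sub d d') = der d' ∘M der d
  unfold unitᵈ = idM
  unfold (tensor {A = A} {B = B} {C = C} {D = D} d d' _) =
    ⌜ct⌝ B D ∘M (der d ⊗M der d') ∘M ⌜ct⁻¹⌝ A C
  unfold (weak w {A₁ = A₁} {A₂} {A₃} _ _ _ d) =
    der d ∘M ⌜ct⌝ A₁ A₃ ∘M (idM ⊗M (l⇒M ∘M (⌜π⌝ w A₂ ⊗M idM)))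
          ∘M (idM ⊗M ⌜ct⁻¹⌝ A₂ A₃) ∘M ⌜ct⁻¹⌝ A₁ (A₂ ++ A₃)
  unfold (exch w {A = A} s _ d) = der d ∘M ⌜σ⌝ w A s
  unfold (contr w {A₁ = A₁} {A} {A₂} _ _ _ d) =
    der d ∘M ⌜ct⌝ A₁ (A ++ A ++ A₂)
          ∘M (idM ⊗M (⌜ct⌝ A (A ++ A₂) ∘M (idM ⊗M ⌜ct⌝ A A₂) ∘M α⇒M
                      ∘M (⌜ct⁻¹⌝ A A ⊗M idM) ∘M (⌜Δ⌝ w A ⊗M idM) ∘M ⌜ct⁻¹⌝ A A₂))
          ∘M ⌜ct⁻¹⌝ A₁ (A ++ A₂)

  data _≈M_ : ∀ {X Y} → Mor X Y → Mor X Y → Set where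
    reflM : ∀ {X Y} {f : Mor X Y} → f ≈M f
    symM : ∀ {X Y} {f g : Mor X Y} → f ≈M g → g ≈M f
    transM : ∀ {X Y} {f g h : Mor X Y} → f ≈M g → g ≈M h → f ≈M h
    assocM : ∀ {X Y Z W} {f : Mor X Y} {g : Mor Y Z} {h : Mor Z W} →
             (h ∘M g) ∘M f ≈M h ∘M (g ∘M f)
    identityˡM : ∀ {X Y} {f : Mor X Y} → idM ∘M f ≈M f
    identityʳM : ∀ {X Y} {f : Mor X Y} → f ∘M idM ≈M f
    ∘-resp-≈M : ∀ {X Y Z} {f h : Mor Y Z} {g i : Mor X Y} → f ≈M h → g ≈M i → f ∘M g ≈M h ∘M i
    ⊗-idM : ∀ {X Y} → idM {X} ⊗M idM {Y} ≈M idM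
    ⊗-∘M : ∀ {X Y Z U V W} {f : Mor Y Z} {g : Mor X Y} {h : Mor V W} {i : Mor U V} →
           (f ∘M g) ⊗M (h ∘M i) ≈M (f ⊗M h) ∘M (g ⊗M i)
    ⊗-resp-≈M : ∀ {X Y U V} {f f' : Mor X Y} {g g' : Mor U V} → f ≈M f' → g ≈M g' → f ⊗M g ≈M f' ⊗M g'
    α-isoˡM : ∀ {X Y Z} → α⇐M ∘M α⇒M ≈M idM {(X ⊗ Y) ⊗ Z}
    α-isoʳM : ∀ {X Y Z} → α⇒M ∘M α⇐M ≈M idM {X ⊗ (Y ⊗ Z)}
    α-naturalM : ∀ {X Y Z U V W} {f : Mor X U} {g : Mor Y V} {h : Mor Z W} →
                 α⇒M ∘M ((f ⊗M g) ⊗M h) ≈M (f ⊗M (g ⊗M h)) ∘M α⇒M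
    l-isoˡM : ∀ {X} → l⇐M ∘M l⇒M ≈M idM {𝟙 ⊗ X}
    l-isoʳM : ∀ {X} → l⇒M ∘M l⇐M ≈M idM {X}
    l-naturalM : ∀ {X Y} {f : Mor X Y} → l⇒M ∘M (idM ⊗M f) ≈M f ∘M l⇒M
    r-isoˡM : ∀ {X} → r⇐M ∘M r⇒M ≈M idM {X ⊗ 𝟙}
    r-isoʳM : ∀ {X} → r⇒M ∘M r⇐M ≈M idM {X}
    r-naturalM : ∀ {X Y} {f : Mor X Y} → r⇒M ∘M (f ⊗M idM) ≈M f ∘M r⇒M
    triangleM : ∀ {X Y} → (idM {X} ⊗M l⇒M {Y}) ∘M α⇒M ≈M r⇒M ⊗M idM {Y}
    pentagonM : ∀ {W X Y Z} →
                (idM {W} ⊗M α⇒M {X} {Y} {Z}) ∘M α⇒M {W} {X ⊗ Y} {Z} ∘M (α⇒M {W} {X} {Y} ⊗M idM {Z})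
                ≈M α⇒M {W} {X} {Y ⊗ Z} ∘M α⇒M {W ⊗ X} {Y} {Z}
    cons-isoˡ : ∀ {a b A} → cons⁻¹ a b A ∘M cons a b A ≈M idM
    cons-isoʳ : ∀ {a b A} → cons a b A ∘M cons⁻¹ a b A ≈M idM
    der-unfold : ∀ {x A t B} (d : Der x A t B) → der d ≈M unfold d
    der-unique : ∀ {x A t B} (d d' : Der x A t B) → der d ≈M der d'
    der-axiom : ∀ i → der (Formula.lhs-der (axiom i)) ≈M der (Formula.rhs-der (axiom i))

  𝐓 : MonCat lzero lzero lzero
  𝐓 = record
    { cat = record
      { Obj = Ob ; _⇒_ = Mor ; _≈_ = _≈M_ ; id = idM ; _∘_ = _∘M_
      ; equiv = record { refl = reflM ; sym = symM ; trans = transM }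
      ; assoc = assocM ; identityˡ = identityˡM ; identityʳ = identityʳM ; ∘-resp-≈ = ∘-resp-≈M }
    ; mon = record
      { _⊗₀_ = _⊗_ ; _⊗₁_ = _⊗M_ ; unit = 𝟙 ; ⊗-id = ⊗-idM ; ⊗-∘ = ⊗-∘M ; ⊗-resp-≈ = ⊗-resp-≈M
      ; α⇒ = α⇒M ; α⇐ = α⇐M ; α-isoˡ = α-isoˡM ; α-isoʳ = α-isoʳM ; α-natural = α-naturalM
      ; l⇒ = l⇒M ; l⇐ = l⇐M ; l-isoˡ = l-isoˡM ; l-isoʳ = l-isoʳM ; l-natural = l-naturalM
      ; r⇒ = r⇒M ; r⇐ = r⇐M ; r-isoˡ = r-isoˡM ; r-isoʳ = r-isoʳM ; r-natural = r-naturalM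
      ; triangle = triangleM ; pentagon = pentagonM } }

  record MonoidallyClosed {p} (P : ∀ {X Y} → Mor X Y → Set p) : Set p where
    infixr 9 _∘ᶜ_
    infixr 10 _⊗ᶜ_
    field
      idᶜ : ∀ {X} → P (idM {X})
      _∘ᶜ_ : ∀ {X Y Z} {f : Mor Y Z} {g : Mor X Y} → P f → P g → P (f ∘M g)
      _⊗ᶜ_ : ∀ {X Y X' Y'} {f : Mor X Y} {g : Mor X' Y'} → P f → P g → P (f ⊗M g)
      α⇒ᶜ : ∀ {X Y Z} → P (α⇒M {X} {Y} {Z})
      α⇐ᶜ : ∀ {X Y Z} → P (α⇐M {X} {Y} {Z})
      l⇒ᶜ : ∀ {X} → P (l⇒M {X})
      l⇐ᶜ : ∀ {X} → P (l⇐M {X})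
      r⇒ᶜ : ∀ {X} → P (r⇒M {X})
      r⇐ᶜ : ∀ {X} → P (r⇐M {X})
      consᶜ : ∀ {a b A} → P (cons a b A)
      cons⁻¹ᶜ : ∀ {a b A} → P (cons⁻¹ a b A)

    ctᶜ : ∀ A B → P (⌜ct⌝ A B)
    ctᶜ [] B = l⇒ᶜ
    ctᶜ (a ∷ []) [] = r⇒ᶜ
    ctᶜ (a ∷ []) (b ∷ B) = consᶜ
    ctᶜ (a ∷ b ∷ A) B = consᶜ ∘ᶜ (idᶜ ⊗ᶜ ctᶜ (b ∷ A) B) ∘ᶜ α⇒ᶜ ∘ᶜ (cons⁻¹ᶜ ⊗ᶜ idᶜ)

    ct⁻¹ᶜ : ∀ A B → P (⌜ct⁻¹⌝ A B)
    ct⁻¹ᶜ [] B = l⇐ᶜ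
    ct⁻¹ᶜ (a ∷ []) [] = r⇐ᶜ
    ct⁻¹ᶜ (a ∷ []) (b ∷ B) = cons⁻¹ᶜ
    ct⁻¹ᶜ (a ∷ b ∷ A) B = (consᶜ ⊗ᶜ idᶜ) ∘ᶜ α⇐ᶜ ∘ᶜ (idᶜ ⊗ᶜ ct⁻¹ᶜ (b ∷ A) B) ∘ᶜ cons⁻¹ᶜ

  record Closed {p} (P : ∀ {X Y} → Mor X Y → Set p) : Set p where
    field
      monoidallyClosed : MonoidallyClosed P
      fnᶜ : ∀ f → P (⌜fn⌝ f)
      πᶜ : ∀ w A → P (⌜π⌝ w A)
      σᶜ : ∀ w A s → P (⌜σ⌝ w A s)
      Δᶜ : ∀ w A → P (⌜Δ⌝ w A)
    open MonoidallyClosed monoidallyClosed public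

    module _ (derᶜ : ∀ {x A t B} (d : Der x A t B) → P (der d)) where
      holds : ∀ {X Y} (f : Mor X Y) → P f
      holds idM = idᶜ
      holds (f ∘M g) = holds f ∘ᶜ holds g
      holds (f ⊗M g) = holds f ⊗ᶜ holds g
      holds α⇒M = α⇒ᶜ
      holds α⇐M = α⇐ᶜ
      holds l⇒M = l⇒ᶜ
      holds l⇐M = l⇐ᶜ
      holds r⇒M = r⇒ᶜ
      holds r⇐M = r⇐ᶜ
      holds (cons a b A) = consᶜ
      holds (cons⁻¹ a b A) = cons⁻¹ᶜ
      holds (der d) = derᶜ d
      holds (⌜fn⌝ f) = fnᶜ f
      holds (⌜π⌝ w A) = πᶜ w A
      holds (⌜σ⌝ w A s) = σᶜ w A s
      holds (⌜Δ⌝ w A) = Δᶜ w A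

    module _ (unfoldᶜ⇒derᶜ : ∀ {x A t B} {d : Der x A t B} → P (unfold d) → P (der d)) where
      mutual
        holds-der : ∀ {x A t B} (d : Der x A t B) → P (der d)
        holds-der d = unfoldᶜ⇒derᶜ (holds-unfold d)

        holds-unfold : ∀ {x A t B} (d : Der x A t B) → P (unfold d)
        holds-unfold (var x a) = idᶜ
        holds-unfold (fun f ds _) = fnᶜ f ∘ᶜ holds-ders ds
        holds-unfold (sub d d') = holds-der d' ∘ᶜ holds-der d
        holds-unfold unitᵈ = idᶜ
        holds-unfold (tensor {A = A} {B = B} {C = C} {D = D} d d' _) =
          ctᶜ B D ∘ᶜ (holds-der d ⊗ᶜ holds-der d') ∘ᶜ ct⁻¹ᶜ A C
        holds-unfold (weak w {A₁ = A₁} {A₂} {A₃} _ _ _ d) =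
          holds-der d ∘ᶜ ctᶜ A₁ A₃ ∘ᶜ (idᶜ ⊗ᶜ (l⇒ᶜ ∘ᶜ (πᶜ w A₂ ⊗ᶜ idᶜ)))
            ∘ᶜ (idᶜ ⊗ᶜ ct⁻¹ᶜ A₂ A₃) ∘ᶜ ct⁻¹ᶜ A₁ (A₂ ++ A₃)
        holds-unfold (exch w {A = A} s _ d) = holds-der d ∘ᶜ σᶜ w A s
        holds-unfold (contr w {A₁ = A₁} {A} {A₂} _ _ _ d) =
          holds-der d ∘ᶜ ctᶜ A₁ (A ++ A ++ A₂)
            ∘ᶜ (idᶜ ⊗ᶜ (ctᶜ A (A ++ A₂) ∘ᶜ (idᶜ ⊗ᶜ ctᶜ A A₂) ∘ᶜ α⇒ᶜ
                        ∘ᶜ (ct⁻¹ᶜ A A ⊗ᶜ idᶜ) ∘ᶜ (Δᶜ w A ⊗ᶜ idᶜ) ∘ᶜ ct⁻¹ᶜ A A₂))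
            ∘ᶜ ct⁻¹ᶜ A₁ (A ++ A₂)

        holds-ders : ∀ {xs As ts bs} (ds : Ders xs As ts bs) → P (ders ds)
        holds-ders []ᵈ = idᶜ
        holds-ders (_∷ᵈ_ {A = A} {b = b} {As = As} {bs = bs} d ds) =
          ctᶜ [ b ] bs ∘ᶜ (holds-der d ⊗ᶜ holds-ders ds) ∘ᶜ ct⁻¹ᶜ A As

  vars : ℕ → List Sort → List ℕ
  vars k [] = []
  vars k (a ∷ A) = k ∷ vars (suc k) A

  varTm : ℕ → List Sort → Tm Fun
  varTm k [] = []
  varTm k (a ∷ A) = var k ∷ varTm (suc k) A

  varTms : ℕ → List Sort → List (Tm Fun)
  varTms k [] = []
  varTms k (a ∷ A) = [ var k ] ∷ varTms (suc k) A

  vars-fresh : ∀ {m k} A → m < k → All (m ≢_) (vars k A)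
  vars-fresh [] m<k = []
  vars-fresh (a ∷ A) m<k = <⇒≢ m<k ∷ vars-fresh A (m<n⇒m<1+n m<k)

  vars-unique : ∀ k A → Unique (vars k A)
  vars-unique k [] = []
  vars-unique k (a ∷ A) = vars-fresh A ≤-refl ∷ vars-unique (suc k) A

  length-vars : ∀ k A → length (vars k A) ≡ length A
  length-vars k [] = P.refl
  length-vars k (a ∷ A) = P.cong suc (length-vars (suc k) A)

  vars-++ : ∀ k A B → vars k (A ++ B) ≡ vars k A ++ vars (k + length A) B
  vars-++ k [] B = P.cong (λ n → vars n B) (P.sym (+-identityʳ k))
  vars-++ k (a ∷ A) B = P.cong (k ∷_) (P.trans (vars-++ (suc k) A B)
                          (P.cong (λ n → vars (suc k) A ++ vars n B) (P.sym (+-suc k (length A)))))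

  id-der : ∀ k A → Der (vars k A) A (varTm k A) A
  id-der k [] = unitᵈ
  id-der k (a ∷ A) = tensor (var k a) (id-der (suc k) A) (vars-unique k (a ∷ A))

  id-ders : ∀ k A → Ders (vars k A) A (varTms k A) A
  id-ders k [] = []ᵈ
  id-ders k (a ∷ A) = var k a ∷ᵈ id-ders (suc k) A

  fun-der : ∀ f → Der (vars 0 (dom f)) (dom f) [ app f (varTms 0 (dom f)) ] [ cod f ]
  fun-der f = fun f (id-ders 0 (dom f)) (vars-unique 0 (dom f))

  weak-der : T weakening → ∀ A → Der (vars 0 A ++ []) (A ++ []) [] []
  weak-der w A = weak w {x₁ = []} {x₂ = vars 0 A} {x₃ = []} {A₁ = []} {A₂ = A} {A₃ = []}
                   P.refl (length-vars 0 A) unique unitᵈ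
    where
    unique : Unique (vars 0 A ++ [])
    unique = P.subst Unique (P.sym (++-identityʳ (vars 0 A))) (vars-unique 0 A)

  exch-der : (w : T exchange) → ∀ A (s : Perm (length A)) →
             Der (permute (vars 0 A) (P.subst Perm (P.sym (length-vars 0 A)) s)) (permute A s) (varTm 0 A) A
  exch-der w A s = exch w s (length-vars 0 A) (id-der 0 A)

  vars-AA : ∀ A → vars 0 (A ++ A ++ []) ≡ vars 0 A ++ vars (length A) A ++ []
  vars-AA A = P.trans (vars-++ 0 A (A ++ [])) (P.cong (vars 0 A ++_) (vars-++ (length A) A []))

  id-der-AA : ∀ A → Der (vars 0 A ++ vars (length A) A ++ []) (A ++ A ++ [])
                        (varTm 0 (A ++ A ++ [])) (A ++ A ++ [])
  id-der-AA A = P.subst (λ x → Der x (A ++ A ++ []) (varTm 0 (A ++ A ++ [])) (A ++ A ++ [])) (vars-AA A)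
                        (id-der 0 (A ++ A ++ []))

  contr-der : T contraction → ∀ A →
              Der (vars 0 A ++ []) (A ++ [])
                  (varTm 0 (A ++ A ++ []) [ map var (vars 0 A) / vars (length A) A ]) (A ++ A ++ [])
  contr-der w A = contr w {x₁ = []} {x = vars 0 A} {x' = vars (length A) A} {x₂ = []} {A₁ = []} {A = A} {A₂ = []}
                    P.refl (length-vars 0 A) (length-vars (length A) A) (id-der-AA A)

  -- Each generator of 𝐓 is, up to coherence isomorphisms, the meaning of a derivation: this is how a
  -- morphism of structures, which only commutes with derivations, commutes with the generators.
  -- The detours through  A ++ []  are needed as the structural rules only yield contexts A₁ ++ A ++ A₂.
  ⌜fn⌝ᵈ : ∀ f → Mor ⌜ dom f ⌝ ⌜ [ cod f ] ⌝
  ⌜fn⌝ᵈ f = der (fun-der f)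

  ⌜π⌝ᵈ : T weakening → ∀ A → Mor ⌜ A ⌝ 𝟙
  ⌜π⌝ᵈ w A = r⇒M ∘M l⇐M ∘M der (weak-der w A) ∘M ⌜ct⌝ A [] ∘M r⇐M

  ⌜σ⌝ᵈ : T exchange → ∀ A (s : Perm (length A)) → Mor ⌜ permute A s ⌝ ⌜ A ⌝
  ⌜σ⌝ᵈ w A s = der (exch-der w A s)

  ⌜Λ⁻¹⌝ : ∀ A → Mor ⌜ A ++ A ++ [] ⌝ (⌜ A ++ A ⌝ ⊗ 𝟙)
  ⌜Λ⁻¹⌝ A = (⌜ct⌝ A A ⊗M idM) ∘M α⇐M ∘M (idM ⊗M ⌜ct⁻¹⌝ A []) ∘M ⌜ct⁻¹⌝ A (A ++ [])

  ⌜Δ⌝ᵈ : T contraction → ∀ A → Mor ⌜ A ⌝ ⌜ A ++ A ⌝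
  ⌜Δ⌝ᵈ w A = r⇒M ∘M ⌜Λ⁻¹⌝ A ∘M der (contr-der w A) ∘M ⌜ct⌝ A [] ∘M r⇐M

  -- Interpreting 𝐓 in a pre-structure

  module _ {o ℓ e} (C : MonCat o ℓ e) where
    open MonoidalReasoning C
    open Semantics lang C

    module _ (obj : Sort → Obj) where
      ct-isoʳ : ∀ A B → ct obj A B ∘ ct⁻¹ obj A B ≈ id
      ct-isoʳ [] B = l-isoʳ
      ct-isoʳ (a ∷ []) [] = r-isoʳ
      ct-isoʳ (a ∷ []) (b ∷ B) = identityˡ
      ct-isoʳ (a ∷ b ∷ A) B = ∘-inverse (⊗-inverse identityˡ (ct-isoʳ (b ∷ A) B)) α-isoʳ

      ct-isoˡ : ∀ A B → ct⁻¹ obj A B ∘ ct obj A B ≈ id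
      ct-isoˡ [] B = l-isoˡ
      ct-isoˡ (a ∷ []) [] = r-isoˡ
      ct-isoˡ (a ∷ []) (b ∷ B) = identityˡ
      ct-isoˡ (a ∷ b ∷ A) B = ∘-inverse α-isoˡ (⊗-inverse identityˡ (ct-isoˡ (b ∷ A) B))

      ct-conjugate-id : ∀ A B {f : ty obj A ⇒ ty obj A} {g : ty obj B ⇒ ty obj B} →
                        f ≈ id → g ≈ id → ct obj A B ∘ (f ⊗₁ g) ∘ ct⁻¹ obj A B ≈ id
      ct-conjugate-id A B p q =
        trans (refl⟩∘⟨ trans (trans (⊗-resp-≈ p q) ⊗-id ⟩∘⟨refl) identityˡ) (ct-isoʳ A B)

    module Interpretation (M : PreStructure) where
      open PreStructure M
      open Interp M public

      ⟦_⟧o : Ob → Obj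
      ⟦ ⌜ A ⌝ ⟧o = ⟦ A ⟧
      ⟦ X ⊗ Y ⟧o = ⟦ X ⟧o ⊗₀ ⟦ Y ⟧o

      ⟦_⟧m : ∀ {X Y} → Mor X Y → ⟦ X ⟧o ⇒ ⟦ Y ⟧o
      ⟦ idM ⟧m = id
      ⟦ f ∘M g ⟧m = ⟦ f ⟧m ∘ ⟦ g ⟧m
      ⟦ f ⊗M g ⟧m = ⟦ f ⟧m ⊗₁ ⟦ g ⟧m
      ⟦ α⇒M ⟧m = α⇒
      ⟦ α⇐M ⟧m = α⇐
      ⟦ l⇒M ⟧m = l⇒
      ⟦ l⇐M ⟧m = l⇐
      ⟦ r⇒M ⟧m = r⇒
      ⟦ r⇐M ⟧m = r⇐
      ⟦ cons a b A ⟧m = id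
      ⟦ cons⁻¹ a b A ⟧m = id
      ⟦ der d ⟧m = ⟦ d ⟧d
      ⟦ ⌜fn⌝ f ⟧m = fn f
      ⟦ ⌜π⌝ w A ⟧m = π w A
      ⟦ ⌜σ⌝ w A s ⟧m = σ w A s
      ⟦ ⌜Δ⌝ w A ⟧m = Δ w A

      ⟦⌜ct⌝⟧ : ∀ A B → ⟦ ⌜ct⌝ A B ⟧m ≈ ct obj A B
      ⟦⌜ct⌝⟧ [] B = refl
      ⟦⌜ct⌝⟧ (a ∷ []) [] = refl
      ⟦⌜ct⌝⟧ (a ∷ []) (b ∷ B) = refl
      ⟦⌜ct⌝⟧ (a ∷ b ∷ A) B =
        trans identityˡ (⊗-resp-≈ refl (⟦⌜ct⌝⟧ (b ∷ A) B) ⟩∘⟨ trans (refl⟩∘⟨ ⊗-id) identityʳ)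

      ⟦⌜ct⁻¹⌝⟧ : ∀ A B → ⟦ ⌜ct⁻¹⌝ A B ⟧m ≈ ct⁻¹ obj A B
      ⟦⌜ct⁻¹⌝⟧ [] B = refl
      ⟦⌜ct⁻¹⌝⟧ (a ∷ []) [] = refl
      ⟦⌜ct⁻¹⌝⟧ (a ∷ []) (b ∷ B) = refl
      ⟦⌜ct⁻¹⌝⟧ (a ∷ b ∷ A) B =
        trans (⊗-id ⟩∘⟨refl) (trans identityˡ (refl⟩∘⟨ trans identityʳ (⊗-resp-≈ refl (⟦⌜ct⁻¹⌝⟧ (b ∷ A) B))))

      ⟦ders⟧ : ∀ {xs As ts bs} (ds : Ders xs As ts bs) → ⟦ ders ds ⟧m ≈ ⟦ ds ⟧ds
      ⟦ders⟧ []ᵈ = refl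
      ⟦ders⟧ (_∷ᵈ_ {A = A} {b = b} {As = As} {bs = bs} d ds) =
        ⟦⌜ct⌝⟧ [ b ] bs ⟩∘⟨ ⊗-resp-≈ refl (⟦ders⟧ ds) ⟩∘⟨ ⟦⌜ct⁻¹⌝⟧ A As

      ⟦unfold⟧ : ∀ {x A t B} (d : Der x A t B) → ⟦ der d ⟧m ≈ ⟦ unfold d ⟧m
      ⟦unfold⟧ (var x a) = refl
      ⟦unfold⟧ (fun f ds _) = refl⟩∘⟨ sym (⟦ders⟧ ds)
      ⟦unfold⟧ (sub d d') = refl
      ⟦unfold⟧ unitᵈ = refl
      ⟦unfold⟧ (tensor {A = A} {B = B} {C = C} {D = D} d d' _) =
        sym (⟦⌜ct⌝⟧ B D ⟩∘⟨ refl⟩∘⟨ ⟦⌜ct⁻¹⌝⟧ A C)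
      ⟦unfold⟧ (weak w {A₁ = A₁} {A₂} {A₃} _ _ _ d) =
        sym (refl⟩∘⟨ (⟦⌜ct⌝⟧ A₁ A₃ ⟩∘⟨ refl⟩∘⟨ (⊗-resp-≈ refl (⟦⌜ct⁻¹⌝⟧ A₂ A₃) ⟩∘⟨ ⟦⌜ct⁻¹⌝⟧ A₁ (A₂ ++ A₃))))
      ⟦unfold⟧ (exch w s _ d) = refl
      ⟦unfold⟧ (contr w {A₁ = A₁} {A} {A₂} _ _ _ d) =
        sym (refl⟩∘⟨ (⟦⌜ct⌝⟧ A₁ (A ++ A ++ A₂)
          ⟩∘⟨ ⊗-resp-≈ refl (⟦⌜ct⌝⟧ A (A ++ A₂) ⟩∘⟨ ⊗-resp-≈ refl (⟦⌜ct⌝⟧ A A₂)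
                ⟩∘⟨ refl⟩∘⟨ (⊗-resp-≈ (⟦⌜ct⁻¹⌝⟧ A A) refl ⟩∘⟨ refl⟩∘⟨ ⟦⌜ct⁻¹⌝⟧ A A₂))
          ⟩∘⟨ ⟦⌜ct⁻¹⌝⟧ A₁ (A ++ A₂)))

      ⟦id-der⟧ : ∀ k A → ⟦ id-der k A ⟧d ≈ id
      ⟦id-der⟧ k [] = refl
      ⟦id-der⟧ k (a ∷ A) = ct-conjugate-id obj [ a ] A refl (⟦id-der⟧ (suc k) A)

      ⟦id-ders⟧ : ∀ k A → ⟦ id-ders k A ⟧ds ≈ id
      ⟦id-ders⟧ k [] = refl
      ⟦id-ders⟧ k (a ∷ A) = ct-conjugate-id obj [ a ] A refl (⟦id-ders⟧ (suc k) A)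

      ⟦subst⟧ : ∀ {x x' A t B} (eq : x ≡ x') (d : Der x A t B) →
                ⟦ P.subst (λ y → Der y A t B) eq d ⟧d ≡ ⟦ d ⟧d
      ⟦subst⟧ P.refl d = P.refl

      ⟦⌜fn⌝ᵈ⟧ : ∀ f → ⟦ ⌜fn⌝ᵈ f ⟧m ≈ fn f
      ⟦⌜fn⌝ᵈ⟧ f = trans (refl⟩∘⟨ ⟦id-ders⟧ 0 (dom f)) identityʳ

      ⟦⌜σ⌝ᵈ⟧ : ∀ w A s → ⟦ ⌜σ⌝ᵈ w A s ⟧m ≈ σ w A s
      ⟦⌜σ⌝ᵈ⟧ w A s = trans (⟦id-der⟧ 0 A ⟩∘⟨refl) identityˡ

      ⟦weak-der⟧ : ∀ w A → ⟦ weak-der w A ⟧d ≈ l⇒ ∘ (π w A ⊗₁ id) ∘ ct⁻¹ obj A []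
      ⟦weak-der⟧ w A =
        trans identityˡ (trans (refl⟩∘⟨ trans sym-assoc (sym split₂ʳ ⟩∘⟨refl)) (trans l-conjugate assoc))

      ⟦⌜π⌝ᵈ⟧ : ∀ w A → ⟦ ⌜π⌝ᵈ w A ⟧m ≈ π w A
      ⟦⌜π⌝ᵈ⟧ w A = begin
        r⇒ ∘ l⇐ ∘ ⟦ weak-der w A ⟧d ∘ ⟦ ⌜ct⌝ A [] ⟧m ∘ r⇐
          ≈⟨ refl⟩∘⟨ refl⟩∘⟨ (⟦weak-der⟧ w A ⟩∘⟨ ⟦⌜ct⌝⟧ A [] ⟩∘⟨refl) ⟩
        r⇒ ∘ l⇐ ∘ (l⇒ ∘ (π w A ⊗₁ id) ∘ ct⁻¹ obj A []) ∘ ct obj A [] ∘ r⇐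
          ≈⟨ refl⟩∘⟨ refl⟩∘⟨ assoc²' ⟩
        r⇒ ∘ l⇐ ∘ l⇒ ∘ (π w A ⊗₁ id) ∘ ct⁻¹ obj A [] ∘ ct obj A [] ∘ r⇐
          ≈⟨ refl⟩∘⟨ cancelˡ l-isoˡ ⟩
        r⇒ ∘ (π w A ⊗₁ id) ∘ ct⁻¹ obj A [] ∘ ct obj A [] ∘ r⇐
          ≈⟨ refl⟩∘⟨ refl⟩∘⟨ cancelˡ (ct-isoˡ obj A []) ⟩
        r⇒ ∘ (π w A ⊗₁ id) ∘ r⇐
          ≈⟨ r-conjugate ⟩
        π w A ∎

      module _ (A : List Sort) where
        Λ : ⟦ A ++ A ⟧ ⊗₀ unit ⇒ ⟦ A ++ A ++ [] ⟧
        Λ = ct obj A (A ++ []) ∘ (id ⊗₁ ct obj A []) ∘ α⇒ ∘ (ct⁻¹ obj A A ⊗₁ id)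

        Λ⁻¹ : ⟦ A ++ A ++ [] ⟧ ⇒ ⟦ A ++ A ⟧ ⊗₀ unit
        Λ⁻¹ = (ct obj A A ⊗₁ id) ∘ α⇐ ∘ (id ⊗₁ ct⁻¹ obj A []) ∘ ct⁻¹ obj A (A ++ [])

        Λ-isoˡ : Λ⁻¹ ∘ Λ ≈ id
        Λ-isoˡ = begin
          Λ⁻¹ ∘ Λ
            ≈⟨ assoc³' ⟩
          (ct obj A A ⊗₁ id) ∘ α⇐ ∘ (id ⊗₁ ct⁻¹ obj A []) ∘ ct⁻¹ obj A (A ++ []) ∘ Λ
            ≈⟨ refl⟩∘⟨ refl⟩∘⟨ refl⟩∘⟨ cancelˡ (ct-isoˡ obj A (A ++ [])) ⟩
          (ct obj A A ⊗₁ id) ∘ α⇐ ∘ (id ⊗₁ ct⁻¹ obj A []) ∘ (id ⊗₁ ct obj A []) ∘ α⇒ ∘ (ct⁻¹ obj A A ⊗₁ id)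
            ≈⟨ refl⟩∘⟨ refl⟩∘⟨ cancelˡ (⊗-inverse identityˡ (ct-isoˡ obj A [])) ⟩
          (ct obj A A ⊗₁ id) ∘ α⇐ ∘ α⇒ ∘ (ct⁻¹ obj A A ⊗₁ id)
            ≈⟨ refl⟩∘⟨ cancelˡ α-isoˡ ⟩
          (ct obj A A ⊗₁ id) ∘ (ct⁻¹ obj A A ⊗₁ id)
            ≈⟨ ⊗-inverse (ct-isoʳ obj A A) identityˡ ⟩
          id ∎

        ⟦⌜Λ⁻¹⌝⟧ : ⟦ ⌜Λ⁻¹⌝ A ⟧m ≈ Λ⁻¹
        ⟦⌜Λ⁻¹⌝⟧ = ⊗-resp-≈ (⟦⌜ct⌝⟧ A A) refl ⟩∘⟨ refl⟩∘⟨ (⊗-resp-≈ refl (⟦⌜ct⁻¹⌝⟧ A []) ⟩∘⟨ ⟦⌜ct⁻¹⌝⟧ A (A ++ []))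

      ⟦contr-der⟧ : ∀ w A → ⟦ contr-der w A ⟧d ≈ Λ A ∘ (Δ w A ⊗₁ id) ∘ ct⁻¹ obj A []
      ⟦contr-der⟧ w A =
        trans (trans (reflexive (⟦subst⟧ (vars-AA A) (id-der 0 (A ++ A ++ []))))
                     (⟦id-der⟧ 0 (A ++ A ++ [])) ⟩∘⟨refl)
              (trans identityˡ (trans l-conjugate (sym assoc³')))

      ⟦⌜Δ⌝ᵈ⟧ : ∀ w A → ⟦ ⌜Δ⌝ᵈ w A ⟧m ≈ Δ w A
      ⟦⌜Δ⌝ᵈ⟧ w A = begin
        r⇒ ∘ ⟦ ⌜Λ⁻¹⌝ A ⟧m ∘ ⟦ contr-der w A ⟧d ∘ ⟦ ⌜ct⌝ A [] ⟧m ∘ r⇐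
          ≈⟨ refl⟩∘⟨ (⟦⌜Λ⁻¹⌝⟧ A ⟩∘⟨ ⟦contr-der⟧ w A ⟩∘⟨ ⟦⌜ct⌝⟧ A [] ⟩∘⟨refl) ⟩
        r⇒ ∘ Λ⁻¹ A ∘ (Λ A ∘ (Δ w A ⊗₁ id) ∘ ct⁻¹ obj A []) ∘ ct obj A [] ∘ r⇐
          ≈⟨ refl⟩∘⟨ refl⟩∘⟨ assoc²' ⟩
        r⇒ ∘ Λ⁻¹ A ∘ Λ A ∘ (Δ w A ⊗₁ id) ∘ ct⁻¹ obj A [] ∘ ct obj A [] ∘ r⇐
          ≈⟨ refl⟩∘⟨ cancelˡ (Λ-isoˡ A) ⟩
        r⇒ ∘ (Δ w A ⊗₁ id) ∘ ct⁻¹ obj A [] ∘ ct obj A [] ∘ r⇐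
          ≈⟨ refl⟩∘⟨ refl⟩∘⟨ cancelˡ (ct-isoˡ obj A []) ⟩
        r⇒ ∘ (Δ w A ⊗₁ id) ∘ r⇐
          ≈⟨ r-conjugate ⟩
        Δ w A ∎

      module _ (structure : IsStructure M) (sat : ∀ i → Satisfies M (axiom i)) where
        sound : ∀ {X Y} {f g : Mor X Y} → f ≈M g → ⟦ f ⟧m ≈ ⟦ g ⟧m
        sound reflM = refl
        sound (symM p) = sym (sound p)
        sound (transM p q) = trans (sound p) (sound q)
        sound assocM = assoc
        sound identityˡM = identityˡ
        sound identityʳM = identityʳ
        sound (∘-resp-≈M p q) = ∘-resp-≈ (sound p) (sound q)
        sound ⊗-idM = ⊗-id
        sound ⊗-∘M = ⊗-∘
        sound (⊗-resp-≈M p q) = ⊗-resp-≈ (sound p) (sound q)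
        sound α-isoˡM = α-isoˡ
        sound α-isoʳM = α-isoʳ
        sound α-naturalM = α-natural
        sound l-isoˡM = l-isoˡ
        sound l-isoʳM = l-isoʳ
        sound l-naturalM = l-natural
        sound r-isoˡM = r-isoˡ
        sound r-isoʳM = r-isoʳ
        sound r-naturalM = r-natural
        sound triangleM = triangle
        sound pentagonM = pentagon
        sound cons-isoˡ = identityˡ
        sound cons-isoʳ = identityˡ
        sound (der-unfold d) = ⟦unfold⟧ d
        sound (der-unique d d') = structure d d'
        sound (der-axiom i) = sat i

    record NaturalAt {F₀ G₀ : Ob → Obj} (F₁ : ∀ {X Y} → Mor X Y → F₀ X ⇒ F₀ Y)
                     (G₁ : ∀ {X Y} → Mor X Y → G₀ X ⇒ G₀ Y) (η : ∀ X → F₀ X ⇒ G₀ X)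
                     {X Y} (f : Mor X Y) : Set e where
      constructor natural-at
      field commutes : η Y ∘ F₁ f ≈ G₁ f ∘ η X
    open NaturalAt public

    module _ {F₀ G₀ : Ob → Obj} {F₁ : ∀ {X Y} → Mor X Y → F₀ X ⇒ F₀ Y}
             {G₁ : ∀ {X Y} → Mor X Y → G₀ X ⇒ G₀ Y} {η : ∀ X → F₀ X ⇒ G₀ X} where

      NaturalAt-resp : ∀ {X Y} {f g : Mor X Y} → F₁ f ≈ F₁ g → G₁ f ≈ G₁ g →
                       NaturalAt F₁ G₁ η f → NaturalAt F₁ G₁ η g
      NaturalAt-resp p q (natural-at n) = natural-at (trans (refl⟩∘⟨ sym p) (trans n (q ⟩∘⟨refl)))

      NaturalAt-∘ : ∀ {X Y Z} {f : Mor Y Z} {g : Mor X Y} →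
                    F₁ (f ∘M g) ≈ F₁ f ∘ F₁ g → G₁ (f ∘M g) ≈ G₁ f ∘ G₁ g →
                    NaturalAt F₁ G₁ η f → NaturalAt F₁ G₁ η g → NaturalAt F₁ G₁ η (f ∘M g)
      NaturalAt-∘ {f = f} {g} F-∘ G-∘ (natural-at p) (natural-at q) = natural-at (begin
        η _ ∘ F₁ (f ∘M g)        ≈⟨ refl⟩∘⟨ F-∘ ⟩
        η _ ∘ F₁ f ∘ F₁ g        ≈⟨ sym-assoc ⟩
        (η _ ∘ F₁ f) ∘ F₁ g      ≈⟨ p ⟩∘⟨refl ⟩
        (G₁ f ∘ η _) ∘ F₁ g      ≈⟨ assoc ⟩
        G₁ f ∘ η _ ∘ F₁ g        ≈⟨ refl⟩∘⟨ q ⟩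
        G₁ f ∘ G₁ g ∘ η _        ≈⟨ sym-assoc ⟩
        (G₁ f ∘ G₁ g) ∘ η _      ≈⟨ sym G-∘ ⟩∘⟨refl ⟩
        G₁ (f ∘M g) ∘ η _        ∎)

      NaturalAt-inverse : ∀ {X Y} {f : Mor X Y} {g : Mor Y X} →
                          F₁ f ∘ F₁ g ≈ id → G₁ g ∘ G₁ f ≈ id →
                          NaturalAt F₁ G₁ η f → NaturalAt F₁ G₁ η g
      NaturalAt-inverse {f = f} {g} Ffg Ggf (natural-at p) = natural-at (sym (begin
        G₁ g ∘ η _                  ≈⟨ refl⟩∘⟨ transposeʳ Ffg refl ⟩
        G₁ g ∘ (η _ ∘ F₁ f) ∘ F₁ g  ≈⟨ refl⟩∘⟨ p ⟩∘⟨refl ⟩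
        G₁ g ∘ (G₁ f ∘ η _) ∘ F₁ g  ≈⟨ refl⟩∘⟨ assoc ⟩
        G₁ g ∘ G₁ f ∘ η _ ∘ F₁ g    ≈⟨ cancelˡ Ggf ⟩
        η _ ∘ F₁ g                  ∎))

    -- Models as strict monoidal functors

    module _ {M N : PreStructure} (h : ∀ a → PreStructure.obj M a ⇒ PreStructure.obj N a) where
      private
        module M = Interpretation M
        module N = Interpretation N

      hextO : ∀ X → M.⟦ X ⟧o ⇒ N.⟦ X ⟧o
      hextO ⌜ A ⌝ = hext h A
      hextO (X ⊗ Y) = hextO X ⊗₁ hextO Y

      hext-monoidallyClosed : MonoidallyClosed (NaturalAt M.⟦_⟧m N.⟦_⟧m hextO)
      hext-monoidallyClosed = record
        { idᶜ = natural-at id-comm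
        ; _∘ᶜ_ = NaturalAt-∘ refl refl
        ; _⊗ᶜ_ = λ (natural-at p) (natural-at q) → natural-at (parallel p q)
        ; α⇒ᶜ = α⇒ᶜ
        ; α⇐ᶜ = NaturalAt-inverse α-isoʳ α-isoˡ α⇒ᶜ
        ; l⇒ᶜ = l⇒ᶜ
        ; l⇐ᶜ = NaturalAt-inverse l-isoʳ l-isoˡ l⇒ᶜ
        ; r⇒ᶜ = r⇒ᶜ
        ; r⇐ᶜ = NaturalAt-inverse r-isoʳ r-isoˡ r⇒ᶜ
        ; consᶜ = natural-at id-comm
        ; cons⁻¹ᶜ = natural-at id-comm
        }
        where
        α⇒ᶜ : ∀ {X Y Z} → NaturalAt M.⟦_⟧m N.⟦_⟧m hextO (α⇒M {X} {Y} {Z})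
        α⇒ᶜ = natural-at (sym α-natural)
        l⇒ᶜ : ∀ {X} → NaturalAt M.⟦_⟧m N.⟦_⟧m hextO (l⇒M {X})
        l⇒ᶜ = natural-at (sym l-natural)
        r⇒ᶜ : ∀ {X} → NaturalAt M.⟦_⟧m N.⟦_⟧m hextO (r⇒M {X})
        r⇒ᶜ = natural-at (sym r-natural)

      module _ (commute : ∀ {x A t B} (d : Der x A t B) → hext h B ∘ M.⟦ d ⟧d ≈ N.⟦ d ⟧d ∘ hext h A) where
        open MonoidallyClosed hext-monoidallyClosed

        derᶜ : ∀ {x A t B} (d : Der x A t B) → NaturalAt M.⟦_⟧m N.⟦_⟧m hextO (der d)
        derᶜ d = natural-at (commute d)

        hext-closed : Closed (NaturalAt M.⟦_⟧m N.⟦_⟧m hextO)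
        hext-closed = record
          { monoidallyClosed = hext-monoidallyClosed
          ; fnᶜ = λ f → NaturalAt-resp (M.⟦⌜fn⌝ᵈ⟧ f) (N.⟦⌜fn⌝ᵈ⟧ f) (derᶜ (fun-der f))
          ; πᶜ = λ w A → NaturalAt-resp (M.⟦⌜π⌝ᵈ⟧ w A) (N.⟦⌜π⌝ᵈ⟧ w A)
                   (r⇒ᶜ ∘ᶜ l⇐ᶜ ∘ᶜ derᶜ (weak-der w A) ∘ᶜ ctᶜ A [] ∘ᶜ r⇐ᶜ)
          ; σᶜ = λ w A s → NaturalAt-resp (M.⟦⌜σ⌝ᵈ⟧ w A s) (N.⟦⌜σ⌝ᵈ⟧ w A s) (derᶜ (exch-der w A s))
          ; Δᶜ = λ w A → NaturalAt-resp (M.⟦⌜Δ⌝ᵈ⟧ w A) (N.⟦⌜Δ⌝ᵈ⟧ w A)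
                   (r⇒ᶜ ∘ᶜ Λ⁻¹ᶜ A ∘ᶜ derᶜ (contr-der w A) ∘ᶜ ctᶜ A [] ∘ᶜ r⇐ᶜ)
          }
          where
          Λ⁻¹ᶜ : ∀ A → NaturalAt M.⟦_⟧m N.⟦_⟧m hextO (⌜Λ⁻¹⌝ A)
          Λ⁻¹ᶜ A = (ctᶜ A A ⊗ᶜ idᶜ) ∘ᶜ α⇐ᶜ ∘ᶜ (idᶜ ⊗ᶜ ct⁻¹ᶜ A []) ∘ᶜ ct⁻¹ᶜ A (A ++ [])

        hextO-natural : ∀ {X Y} (f : Mor X Y) → hextO Y ∘ M.⟦ f ⟧m ≈ N.⟦ f ⟧m ∘ hextO X
        hextO-natural f = commutes (Closed.holds hext-closed derᶜ f)

    hext-resp : ∀ {obj₁ obj₂ : Sort → Obj} {h h' : ∀ a → obj₁ a ⇒ obj₂ a} →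
                (∀ a → h a ≈ h' a) → ∀ A → hext h A ≈ hext h' A
    hext-resp p [] = refl
    hext-resp p (a ∷ []) = p a
    hext-resp p (a ∷ b ∷ A) = ⊗-resp-≈ (p a) (hext-resp p (b ∷ A))

    module _ {M N : PreStructure} where
      hextO-resp : ∀ {h h' : ∀ a → PreStructure.obj M a ⇒ PreStructure.obj N a} →
                   (∀ a → h a ≈ h' a) → ∀ X → hextO {M} {N} h X ≈ hextO {M} {N} h' X
      hextO-resp p ⌜ A ⌝ = hext-resp p A
      hextO-resp p (X ⊗ Y) = ⊗-resp-≈ (hextO-resp p X) (hextO-resp p Y)

      hextO-∘ : ∀ {K : PreStructure} (g : ∀ a → PreStructure.obj N a ⇒ PreStructure.obj K a)
                (f : ∀ a → PreStructure.obj M a ⇒ PreStructure.obj N a) X →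
                hextO {M} {K} (λ a → g a ∘ f a) X ≈ hextO {N} {K} g X ∘ hextO {M} {N} f X
      hextO-∘ g f ⌜ A ⌝ = hext-∘ g f A
      hextO-∘ g f (X ⊗ Y) = trans (⊗-resp-≈ (hextO-∘ g f X) (hextO-∘ g f Y)) ⊗-∘

    hextO-id : ∀ {M : PreStructure} X → hextO {M} {M} (λ a → id) X ≈ id
    hextO-id ⌜ A ⌝ = hext-id A
    hextO-id (X ⊗ Y) = trans (⊗-resp-≈ (hextO-id X) (hextO-id Y)) ⊗-id

    interpret : Model Th C → SMFunctor 𝐓 C
    interpret M = record
      { F₀ = ⟦_⟧o ; F₁ = ⟦_⟧m ; F-resp-≈ = sound (Model.structure M) (Model.sat M)
      ; F-id = refl ; F-∘ = refl
      ; φ = id ; φ⁻¹ = id ; φ-isoˡ = identityˡ ; φ-isoʳ = identityˡ ; φ-natural = id-comm-sym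
      ; ε = id ; ε⁻¹ = id ; ε-isoˡ = identityˡ ; ε-isoʳ = identityˡ
      ; φ-assoc = trans (refl⟩∘⟨ id∘id⊗id) (trans id-comm (refl⟩∘⟨ sym (trans (⊗-id ⟩∘⟨refl) identityˡ)))
      ; φ-unitˡ = trans (refl⟩∘⟨ id∘id⊗id) identityʳ
      ; φ-unitʳ = trans (refl⟩∘⟨ id∘id⊗id) identityʳ
      }
      where
      open Interpretation (Model.pre M)
      id∘id⊗id : ∀ {X Y} → id ∘ (id {X} ⊗₁ id {Y}) ≈ id
      id∘id⊗id = trans identityˡ ⊗-id

    interpretHom : ∀ {M N : Model Th C} → PreHom (Model.pre M) (Model.pre N) →
                   MonNat (interpret M) (interpret N)
    interpretHom {M} {N} H = record
      { η = hextO {Model.pre M} {Model.pre N} (PreHom.h H)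
      ; natural = λ {X} {Y} {f} → hextO-natural (PreHom.h H) (PreHom.commute H) f
      ; monoidal = id-comm
      ; monoidal-unit = identityˡ
      }

    Ψ : Functor (ModCat Th C) (HomCat 𝐓 C)
    Ψ = record
      { F₀ = interpret
      ; F₁ = interpretHom
      ; F-resp-≈ = λ {M} {N} → hextO-resp {Model.pre M} {Model.pre N}
      ; F-id = λ {M} → hextO-id {Model.pre M}
      ; F-∘ = λ {M} {N} {K} {f} {g} → hextO-∘ {Model.pre M} {Model.pre N} {Model.pre K} (PreHom.h g) (PreHom.h f)
      }

    -- The model induced by a strong monoidal functor

    module Induced (G : SMFunctor 𝐓 C) where
      private module G = StrongMonoidalReasoning G

      obj : Sort → Obj
      obj a = G.F₀ ⌜ [ a ] ⌝

      ext : ∀ A → ty obj A ⇒ G.F₀ ⌜ A ⌝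
      ext [] = G.ε
      ext (a ∷ []) = id
      ext (a ∷ b ∷ A) = G.F₁ (cons a b A) ∘ G.φ ∘ (id ⊗₁ ext (b ∷ A))

      ext⁻¹ : ∀ A → G.F₀ ⌜ A ⌝ ⇒ ty obj A
      ext⁻¹ [] = G.ε⁻¹
      ext⁻¹ (a ∷ []) = id
      ext⁻¹ (a ∷ b ∷ A) = (id ⊗₁ ext⁻¹ (b ∷ A)) ∘ G.φ⁻¹ ∘ G.F₁ (cons⁻¹ a b A)

      ext-isoˡ : ∀ A → ext⁻¹ A ∘ ext A ≈ id
      ext-isoˡ [] = G.ε-isoˡ
      ext-isoˡ (a ∷ []) = identityˡ
      ext-isoˡ (a ∷ b ∷ A) =
        ∘-inverse₃ (⊗-inverse identityˡ (ext-isoˡ (b ∷ A))) G.φ-isoˡ (G.F-inverse cons-isoˡ)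

      ext-isoʳ : ∀ A → ext A ∘ ext⁻¹ A ≈ id
      ext-isoʳ [] = G.ε-isoʳ
      ext-isoʳ (a ∷ []) = identityˡ
      ext-isoʳ (a ∷ b ∷ A) =
        ∘-inverse₃ (G.F-inverse cons-isoʳ) G.φ-isoʳ (⊗-inverse identityˡ (ext-isoʳ (b ∷ A)))

      transfer : ∀ {A B} → Mor ⌜ A ⌝ ⌜ B ⌝ → ty obj A ⇒ ty obj B
      transfer {A} {B} f = ext⁻¹ B ∘ G.F₁ f ∘ ext A

      transfer-resp : ∀ {A B} {f g : Mor ⌜ A ⌝ ⌜ B ⌝} → f ≈M g → transfer f ≈ transfer g
      transfer-resp p = refl⟩∘⟨ G.F-resp-≈ p ⟩∘⟨refl

      transfer-commutes : ∀ {A B} (f : Mor ⌜ A ⌝ ⌜ B ⌝) → ext⁻¹ B ∘ G.F₁ f ≈ transfer f ∘ ext⁻¹ A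
      transfer-commutes {A} f = sym (trans assoc (refl⟩∘⟨ cancelʳ (ext-isoʳ A)))

      pre : PreStructure
      pre = record
        { obj = obj
        ; fn = λ f → transfer (⌜fn⌝ f)
        ; π = λ w A → transfer (⌜π⌝ w A)
        ; σ = λ w A s → transfer (⌜σ⌝ w A s)
        ; Δ = λ w A → transfer (⌜Δ⌝ w A)
        }

      open Interpretation pre public

      η : ∀ X → G.F₀ X ⇒ ⟦ X ⟧o
      η ⌜ A ⌝ = ext⁻¹ A
      η (X ⊗ Y) = (η X ⊗₁ η Y) ∘ G.φ⁻¹

      η⁻¹ : ∀ X → ⟦ X ⟧o ⇒ G.F₀ X
      η⁻¹ ⌜ A ⌝ = ext A
      η⁻¹ (X ⊗ Y) = G.φ ∘ (η⁻¹ X ⊗₁ η⁻¹ Y)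

      η-isoˡ : ∀ X → η⁻¹ X ∘ η X ≈ id
      η-isoˡ ⌜ A ⌝ = ext-isoʳ A
      η-isoˡ (X ⊗ Y) = ∘-inverse G.φ-isoʳ (⊗-inverse (η-isoˡ X) (η-isoˡ Y))

      η-isoʳ : ∀ X → η X ∘ η⁻¹ X ≈ id
      η-isoʳ ⌜ A ⌝ = ext-isoˡ A
      η-isoʳ (X ⊗ Y) = ∘-inverse (⊗-inverse (η-isoʳ X) (η-isoʳ Y)) G.φ-isoˡ

      Natural : ∀ {X Y} → Mor X Y → Set e
      Natural = NaturalAt G.F₁ ⟦_⟧m η

      α⇒ᶜ : ∀ {X Y Z} → Natural (α⇒M {X} {Y} {Z})
      α⇒ᶜ {X} {Y} {Z} = natural-at (begin
        ((η X ⊗₁ ((η Y ⊗₁ η Z) ∘ G.φ⁻¹)) ∘ G.φ⁻¹) ∘ G.F₁ α⇒M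
          ≈⟨ split₂ʳ ⟩∘⟨refl ⟩∘⟨refl ⟩
        (((η X ⊗₁ η Y ⊗₁ η Z) ∘ (id ⊗₁ G.φ⁻¹)) ∘ G.φ⁻¹) ∘ G.F₁ α⇒M
          ≈⟨ trans assoc assoc ⟩
        (η X ⊗₁ η Y ⊗₁ η Z) ∘ (id ⊗₁ G.φ⁻¹) ∘ G.φ⁻¹ ∘ G.F₁ α⇒M
          ≈⟨ refl⟩∘⟨ G.φ⁻¹-assoc ⟩
        (η X ⊗₁ η Y ⊗₁ η Z) ∘ α⇒ ∘ (G.φ⁻¹ ⊗₁ id) ∘ G.φ⁻¹
          ≈⟨ pullˡ (sym α-natural) ⟩
        (α⇒ ∘ ((η X ⊗₁ η Y) ⊗₁ η Z)) ∘ (G.φ⁻¹ ⊗₁ id) ∘ G.φ⁻¹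
          ≈⟨ trans assoc (refl⟩∘⟨ sym-assoc) ⟩
        α⇒ ∘ (((η X ⊗₁ η Y) ⊗₁ η Z) ∘ (G.φ⁻¹ ⊗₁ id)) ∘ G.φ⁻¹
          ≈⟨ refl⟩∘⟨ sym split₁ʳ ⟩∘⟨refl ⟩
        α⇒ ∘ (((η X ⊗₁ η Y) ∘ G.φ⁻¹) ⊗₁ η Z) ∘ G.φ⁻¹ ∎)

      l⇒ᶜ : ∀ {X} → Natural (l⇒M {X})
      l⇒ᶜ {X} = natural-at (begin
        η X ∘ G.F₁ l⇒M                              ≈⟨ refl⟩∘⟨ G.F-l⇒ ⟩
        η X ∘ l⇒ ∘ (G.ε⁻¹ ⊗₁ id) ∘ G.φ⁻¹            ≈⟨ pullˡ (sym l-natural) ⟩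
        (l⇒ ∘ (id ⊗₁ η X)) ∘ (G.ε⁻¹ ⊗₁ id) ∘ G.φ⁻¹  ≈⟨ trans assoc (refl⟩∘⟨ sym-assoc) ⟩
        l⇒ ∘ ((id ⊗₁ η X) ∘ (G.ε⁻¹ ⊗₁ id)) ∘ G.φ⁻¹  ≈⟨ refl⟩∘⟨ sym serialize₂₁ ⟩∘⟨refl ⟩
        l⇒ ∘ (G.ε⁻¹ ⊗₁ η X) ∘ G.φ⁻¹                 ∎)

      r⇒ᶜ : ∀ {X} → Natural (r⇒M {X})
      r⇒ᶜ {X} = natural-at (begin
        η X ∘ G.F₁ r⇒M                              ≈⟨ refl⟩∘⟨ G.F-r⇒ ⟩
        η X ∘ r⇒ ∘ (id ⊗₁ G.ε⁻¹) ∘ G.φ⁻¹            ≈⟨ pullˡ (sym r-natural) ⟩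
        (r⇒ ∘ (η X ⊗₁ id)) ∘ (id ⊗₁ G.ε⁻¹) ∘ G.φ⁻¹  ≈⟨ trans assoc (refl⟩∘⟨ sym-assoc) ⟩
        r⇒ ∘ ((η X ⊗₁ id) ∘ (id ⊗₁ G.ε⁻¹)) ∘ G.φ⁻¹  ≈⟨ refl⟩∘⟨ sym serialize₁₂ ⟩∘⟨refl ⟩
        r⇒ ∘ (η X ⊗₁ G.ε⁻¹) ∘ G.φ⁻¹                 ∎)

      consᶜ : ∀ {a b A} → Natural (cons a b A)
      consᶜ = natural-at (trans assoc²' (trans (refl⟩∘⟨ refl⟩∘⟨ G.F-inverse cons-isoˡ)
                                               (trans (refl⟩∘⟨ identityʳ) (sym identityˡ))))

      _⊗ᶜ_ : ∀ {X Y X' Y'} {f : Mor X Y} {g : Mor X' Y'} → Natural f → Natural g → Natural (f ⊗M g)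
      _⊗ᶜ_ {X} {Y} {X'} {Y'} {f} {g} (natural-at p) (natural-at q) = natural-at (begin
        ((η Y ⊗₁ η Y') ∘ G.φ⁻¹) ∘ G.F₁ (f ⊗M g)        ≈⟨ assoc ⟩
        (η Y ⊗₁ η Y') ∘ G.φ⁻¹ ∘ G.F₁ (f ⊗M g)          ≈⟨ refl⟩∘⟨ G.φ⁻¹-natural ⟩
        (η Y ⊗₁ η Y') ∘ (G.F₁ f ⊗₁ G.F₁ g) ∘ G.φ⁻¹     ≈⟨ sym-assoc ⟩
        ((η Y ⊗₁ η Y') ∘ (G.F₁ f ⊗₁ G.F₁ g)) ∘ G.φ⁻¹   ≈⟨ parallel p q ⟩∘⟨refl ⟩
        ((⟦ f ⟧m ⊗₁ ⟦ g ⟧m) ∘ (η X ⊗₁ η X')) ∘ G.φ⁻¹   ≈⟨ assoc ⟩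
        (⟦ f ⟧m ⊗₁ ⟦ g ⟧m) ∘ (η X ⊗₁ η X') ∘ G.φ⁻¹     ∎)

      η-closed : Closed Natural
      η-closed = record
        { monoidallyClosed = record
          { idᶜ = natural-at (trans (refl⟩∘⟨ G.F-id) id-comm)
          ; _∘ᶜ_ = NaturalAt-∘ G.F-∘ refl
          ; _⊗ᶜ_ = _⊗ᶜ_
          ; α⇒ᶜ = α⇒ᶜ
          ; α⇐ᶜ = NaturalAt-inverse (G.F-inverse α-isoʳM) α-isoˡ α⇒ᶜ
          ; l⇒ᶜ = l⇒ᶜ
          ; l⇐ᶜ = NaturalAt-inverse (G.F-inverse l-isoʳM) l-isoˡ l⇒ᶜ
          ; r⇒ᶜ = r⇒ᶜ
          ; r⇐ᶜ = NaturalAt-inverse (G.F-inverse r-isoʳM) r-isoˡ r⇒ᶜ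
          ; consᶜ = consᶜ
          ; cons⁻¹ᶜ = NaturalAt-inverse (G.F-inverse cons-isoʳ) identityˡ consᶜ
          }
        ; fnᶜ = λ f → natural-at (transfer-commutes (⌜fn⌝ f))
        ; πᶜ = λ w A → natural-at (transfer-commutes (⌜π⌝ w A))
        ; σᶜ = λ w A s → natural-at (transfer-commutes (⌜σ⌝ w A s))
        ; Δᶜ = λ w A → natural-at (transfer-commutes (⌜Δ⌝ w A))
        }

      η-natural : ∀ {X Y} (f : Mor X Y) → η Y ∘ G.F₁ f ≈ ⟦ f ⟧m ∘ η X
      η-natural f = commutes (Closed.holds η-closed (Closed.holds-der η-closed unfold⇒der) f)
        where
        unfold⇒der : ∀ {x A t B} {d : Der x A t B} → Natural (unfold d) → Natural (der d)
        unfold⇒der {d = d} = NaturalAt-resp (G.F-resp-≈ (symM (der-unfold d))) (sym (⟦unfold⟧ d))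

      ⟦⟧≈transfer : ∀ {x A t B} (d : Der x A t B) → ⟦ d ⟧d ≈ transfer (der d)
      ⟦⟧≈transfer {A = A} d = trans (transposeʳ (ext-isoˡ A) (sym (η-natural (der d)))) assoc

      ⟦⟧-resp-≈M : ∀ {x x' A t t' B} {d : Der x A t B} {d' : Der x' A t' B} → der d ≈M der d' → ⟦ d ⟧d ≈ ⟦ d' ⟧d
      ⟦⟧-resp-≈M {d = d} {d'} p = trans (⟦⟧≈transfer d) (trans (transfer-resp p) (sym (⟦⟧≈transfer d')))

      model : Model Th C
      model = record
        { pre = pre
        ; structure = λ d d' → ⟦⟧-resp-≈M (der-unique d d')
        ; sat = λ i → ⟦⟧-resp-≈M (der-axiom i)
        }

      η-monNat : MonNat G (interpret model)
      η-monNat = record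
        { η = η
        ; natural = λ {X} {Y} {f} → η-natural f
        ; monoidal = trans (cancelʳ G.φ-isoˡ) (sym identityˡ)
        ; monoidal-unit = G.ε-isoˡ
        }

      η⁻¹-monNat : MonNat (interpret model) G
      η⁻¹-monNat = record
        { η = η⁻¹
        ; natural = λ {X} {Y} {f} → sym (inverse-square (η-isoʳ X) (η-isoˡ Y) (η-natural f))
        ; monoidal = identityʳ
        ; monoidal-unit = identityʳ
        }

    module _ {G G' : SMFunctor 𝐓 C} (τ : MonNat G G') where
      private
        module I = Induced G
        module I' = Induced G'
        module τ = MonNatReasoning τ
        module G = SMFunctor G
        module G' = SMFunctor G'

      hτ : ∀ a → I.obj a ⇒ I'.obj a
      hτ a = τ.η ⌜ [ a ] ⌝

      ext⁻¹-natural : ∀ A → I'.ext⁻¹ A ∘ τ.η ⌜ A ⌝ ≈ hext hτ A ∘ I.ext⁻¹ A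
      ext⁻¹-natural [] = trans τ.monoidal-unit⁻¹ (sym identityˡ)
      ext⁻¹-natural (a ∷ []) = id-comm-sym
      ext⁻¹-natural (a ∷ b ∷ A) = begin
        ((id ⊗₁ I'.ext⁻¹ (b ∷ A)) ∘ G'.φ⁻¹ ∘ G'.F₁ (cons⁻¹ a b A)) ∘ τ.η ⌜ a ∷ b ∷ A ⌝
          ≈⟨ assoc²' ⟩
        (id ⊗₁ I'.ext⁻¹ (b ∷ A)) ∘ G'.φ⁻¹ ∘ G'.F₁ (cons⁻¹ a b A) ∘ τ.η ⌜ a ∷ b ∷ A ⌝
          ≈⟨ refl⟩∘⟨ refl⟩∘⟨ sym τ.natural ⟩
        (id ⊗₁ I'.ext⁻¹ (b ∷ A)) ∘ G'.φ⁻¹ ∘ τ.η (⌜ [ a ] ⌝ ⊗ ⌜ b ∷ A ⌝) ∘ G.F₁ (cons⁻¹ a b A)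
          ≈⟨ refl⟩∘⟨ pullˡ τ.monoidal⁻¹ ⟩
        (id ⊗₁ I'.ext⁻¹ (b ∷ A)) ∘ ((hτ a ⊗₁ τ.η ⌜ b ∷ A ⌝) ∘ G.φ⁻¹) ∘ G.F₁ (cons⁻¹ a b A)
          ≈⟨ refl⟩∘⟨ assoc ⟩
        (id ⊗₁ I'.ext⁻¹ (b ∷ A)) ∘ (hτ a ⊗₁ τ.η ⌜ b ∷ A ⌝) ∘ G.φ⁻¹ ∘ G.F₁ (cons⁻¹ a b A)
          ≈⟨ pullˡ (parallel id-comm-sym (ext⁻¹-natural (b ∷ A))) ⟩
        ((hτ a ⊗₁ hext hτ (b ∷ A)) ∘ (id ⊗₁ I.ext⁻¹ (b ∷ A))) ∘ G.φ⁻¹ ∘ G.F₁ (cons⁻¹ a b A)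
          ≈⟨ assoc ⟩
        (hτ a ⊗₁ hext hτ (b ∷ A)) ∘ (id ⊗₁ I.ext⁻¹ (b ∷ A)) ∘ G.φ⁻¹ ∘ G.F₁ (cons⁻¹ a b A) ∎

      ext-natural : ∀ A → τ.η ⌜ A ⌝ ∘ I.ext A ≈ I'.ext A ∘ hext hτ A
      ext-natural A = inverse-square (I.ext-isoˡ A) (I'.ext-isoʳ A) (ext⁻¹-natural A)

      transfer-natural : ∀ {A B} (f : Mor ⌜ A ⌝ ⌜ B ⌝) → hext hτ B ∘ I.transfer f ≈ I'.transfer f ∘ hext hτ A
      transfer-natural {A} {B} f = begin
        hext hτ B ∘ I.ext⁻¹ B ∘ G.F₁ f ∘ I.ext A            ≈⟨ pullˡ (sym (ext⁻¹-natural B)) ⟩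
        (I'.ext⁻¹ B ∘ τ.η ⌜ B ⌝) ∘ G.F₁ f ∘ I.ext A          ≈⟨ assoc ⟩
        I'.ext⁻¹ B ∘ τ.η ⌜ B ⌝ ∘ G.F₁ f ∘ I.ext A            ≈⟨ refl⟩∘⟨ pullˡ τ.natural ⟩
        I'.ext⁻¹ B ∘ (G'.F₁ f ∘ τ.η ⌜ A ⌝) ∘ I.ext A         ≈⟨ refl⟩∘⟨ assoc ⟩
        I'.ext⁻¹ B ∘ G'.F₁ f ∘ τ.η ⌜ A ⌝ ∘ I.ext A           ≈⟨ refl⟩∘⟨ refl⟩∘⟨ ext-natural A ⟩
        I'.ext⁻¹ B ∘ G'.F₁ f ∘ I'.ext A ∘ hext hτ A          ≈⟨ sym assoc²' ⟩
        (I'.ext⁻¹ B ∘ G'.F₁ f ∘ I'.ext A) ∘ hext hτ A        ∎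

      inducedHom : PreHom I.pre I'.pre
      inducedHom = record
        { h = hτ
        ; commute = λ {x} {A} {t} {B} d → begin
            hext hτ B ∘ I.⟦ d ⟧d          ≈⟨ refl⟩∘⟨ I.⟦⟧≈transfer d ⟩
            hext hτ B ∘ I.transfer (der d)           ≈⟨ transfer-natural (der d) ⟩
            I'.transfer (der d) ∘ hext hτ A          ≈⟨ sym (I'.⟦⟧≈transfer d) ⟩∘⟨refl ⟩
            I'.⟦ d ⟧d ∘ hext hτ A         ∎
        }

      η-natural-in-G : ∀ X → I'.η X ∘ τ.η X ≈ hextO {I.pre} {I'.pre} hτ X ∘ I.η X
      η-natural-in-G ⌜ A ⌝ = ext⁻¹-natural A
      η-natural-in-G (X ⊗ Y) = begin
        ((I'.η X ⊗₁ I'.η Y) ∘ G'.φ⁻¹) ∘ τ.η (X ⊗ Y)               ≈⟨ trans assoc (refl⟩∘⟨ τ.monoidal⁻¹) ⟩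
        (I'.η X ⊗₁ I'.η Y) ∘ (τ.η X ⊗₁ τ.η Y) ∘ G.φ⁻¹             ≈⟨ pullˡ (parallel (η-natural-in-G X) (η-natural-in-G Y)) ⟩
        ((hextO hτ X ⊗₁ hextO hτ Y) ∘ (I.η X ⊗₁ I.η Y)) ∘ G.φ⁻¹   ≈⟨ assoc ⟩
        (hextO hτ X ⊗₁ hextO hτ Y) ∘ (I.η X ⊗₁ I.η Y) ∘ G.φ⁻¹     ∎

    Φ : Functor (HomCat 𝐓 C) (ModCat Th C)
    Φ = record
      { F₀ = Induced.model
      ; F₁ = inducedHom
      ; F-resp-≈ = λ p a → p ⌜ [ a ] ⌝
      ; F-id = λ a → refl
      ; F-∘ = λ a → refl
      }

    identity-commutes : ∀ {obj : Sort → Obj} {I J : ∀ {x A t B} → Der x A t B → ty obj A ⇒ ty obj B} →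
                        (∀ {x A t B} (d : Der x A t B) → I d ≈ J d) →
                        ∀ {x A t B} (d : Der x A t B) → hext (λ a → id {obj a}) B ∘ I d ≈ J d ∘ hext (λ a → id) A
    identity-commutes I≈J {A = A} {B = B} d =
      trans (hext-id B ⟩∘⟨refl) (trans identityˡ (trans (I≈J d) (sym (trans (refl⟩∘⟨ hext-id A) identityʳ))))

    module _ (M : Model Th C) where
      private
        module I = Induced (interpret M)
        module M = Interpretation (Model.pre M)

      ext⁻¹≈id : ∀ A → I.ext⁻¹ A ≈ id
      ext⁻¹≈id [] = refl
      ext⁻¹≈id (a ∷ []) = refl
      ext⁻¹≈id (a ∷ b ∷ A) = trans (trans (⊗-resp-≈ refl (ext⁻¹≈id (b ∷ A))) ⊗-id ⟩∘⟨ identityˡ) identityˡ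

      ⟦induced⟧≈⟦⟧ : ∀ {x A t B} (d : Der x A t B) → I.⟦ d ⟧d ≈ M.⟦ d ⟧d
      ⟦induced⟧≈⟦⟧ {A = A} {B = B} d = begin
        I.⟦ d ⟧d                ≈⟨ sym identityʳ ⟩
        I.⟦ d ⟧d ∘ id           ≈⟨ refl⟩∘⟨ sym (ext⁻¹≈id A) ⟩
        I.⟦ d ⟧d ∘ I.ext⁻¹ A    ≈⟨ sym (I.η-natural (der d)) ⟩
        I.ext⁻¹ B ∘ M.⟦ d ⟧d    ≈⟨ ext⁻¹≈id B ⟩∘⟨refl ⟩
        id ∘ M.⟦ d ⟧d           ≈⟨ identityˡ ⟩
        M.⟦ d ⟧d                ∎

      counit : PreHom I.pre (Model.pre M)
      counit = record { h = λ a → id ; commute = identity-commutes ⟦induced⟧≈⟦⟧ }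

      counit⁻¹ : PreHom (Model.pre M) I.pre
      counit⁻¹ = record { h = λ a → id ; commute = identity-commutes (λ d → sym (⟦induced⟧≈⟦⟧ d)) }

    equivalence : Equivalence (HomCat 𝐓 C) (ModCat Th C)
    equivalence = record
      { Φ = Φ
      ; Ψ = Ψ
      ; unit = Induced.η-monNat
      ; unit⁻¹ = Induced.η⁻¹-monNat
      ; unit-isoˡ = Induced.η-isoˡ
      ; unit-isoʳ = Induced.η-isoʳ
      ; unit-natural = η-natural-in-G
      ; counit = counit
      ; counit⁻¹ = counit⁻¹
      ; counit-isoˡ = λ M a → identityˡ
      ; counit-isoʳ = λ M a → identityˡ
      ; counit-natural = λ f a → id-comm-sym
      }

    module _ (M : PreStructure) where
      open PreStructure M

      module _ {fn' : ∀ f → ty obj (dom f) ⇒ obj (cod f)}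
               {π' : T weakening → ∀ A → ty obj A ⇒ unit}
               {σ' : T exchange → ∀ A (s : Perm (length A)) → ty obj (permute A s) ⇒ ty obj A}
               {Δ' : T contraction → ∀ A → ty obj A ⇒ ty obj (A ++ A)}
               (fn≈ : ∀ f → fn f ≈ fn' f) (π≈ : ∀ w A → π w A ≈ π' w A)
               (σ≈ : ∀ w A s → σ w A s ≈ σ' w A s) (Δ≈ : ∀ w A → Δ w A ≈ Δ' w A) where
        private
          M' : PreStructure
          M' = record M { fn = fn' ; π = π' ; σ = σ' ; Δ = Δ' }
          module I = Interp M
          module I' = Interp M'

        mutual
          ⟦⟧-resp-operations : ∀ {x A t B} (d : Der x A t B) → I.⟦ d ⟧d ≈ I'.⟦ d ⟧d
          ⟦⟧-resp-operations (var x a) = refl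
          ⟦⟧-resp-operations (fun f ds _) = fn≈ f ⟩∘⟨ ⟦⟧s-resp-operations ds
          ⟦⟧-resp-operations (sub d d') = ⟦⟧-resp-operations d' ⟩∘⟨ ⟦⟧-resp-operations d
          ⟦⟧-resp-operations unitᵈ = refl
          ⟦⟧-resp-operations (tensor d d' _) =
            refl⟩∘⟨ ⊗-resp-≈ (⟦⟧-resp-operations d) (⟦⟧-resp-operations d') ⟩∘⟨refl
          ⟦⟧-resp-operations (weak w {A₂ = A₂} _ _ _ d) =
            ⟦⟧-resp-operations d ⟩∘⟨ refl⟩∘⟨ ⊗-resp-≈ refl (refl⟩∘⟨ ⊗-resp-≈ (π≈ w A₂) refl) ⟩∘⟨refl
          ⟦⟧-resp-operations (exch w {A = A} s _ d) = ⟦⟧-resp-operations d ⟩∘⟨ σ≈ w A s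
          ⟦⟧-resp-operations (contr w {A = A} _ _ _ d) =
            ⟦⟧-resp-operations d ⟩∘⟨ refl⟩∘⟨
              ⊗-resp-≈ refl (refl⟩∘⟨ refl⟩∘⟨ refl⟩∘⟨ refl⟩∘⟨ ⊗-resp-≈ (Δ≈ w A) refl ⟩∘⟨refl) ⟩∘⟨refl

          ⟦⟧s-resp-operations : ∀ {xs As ts bs} (ds : Ders xs As ts bs) → I.⟦ ds ⟧ds ≈ I'.⟦ ds ⟧ds
          ⟦⟧s-resp-operations []ᵈ = refl
          ⟦⟧s-resp-operations (d ∷ᵈ ds) =
            refl⟩∘⟨ ⊗-resp-≈ (⟦⟧-resp-operations d) (⟦⟧s-resp-operations ds) ⟩∘⟨refl

  -- Naturality in C

  module _ {o ℓ e o' ℓ' e'} {C : MonCat o ℓ e} {D : MonCat o' ℓ' e'}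
           (F : SMFunctor C D) (G : SMFunctor 𝐓 C) where
    open MonoidalReasoning D
    open Semantics lang D
    open Transport lang F
    private
      module C = MonCat C
      module F = StrongMonoidalReasoning F
      module G = SMFunctor G
      module I = Induced C G
      module FI = Induced D (F ∘SM G)

    ext-∘SM : ∀ A → FI.ext A ≈ F.F₁ (I.ext A) ∘ φext I.obj A
    ext-∘SM [] = refl
    ext-∘SM (a ∷ []) = sym (trans identityʳ F.F-id)
    ext-∘SM (a ∷ b ∷ A) = begin
      F.F₁ (G.F₁ (cons a b A)) ∘ (F.F₁ G.φ ∘ F.φ) ∘ (id ⊗₁ FI.ext (b ∷ A))
        ≈⟨ refl⟩∘⟨ assoc ⟩
      F.F₁ (G.F₁ (cons a b A)) ∘ F.F₁ G.φ ∘ F.φ ∘ (id ⊗₁ FI.ext (b ∷ A))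
        ≈⟨ refl⟩∘⟨ refl⟩∘⟨ refl⟩∘⟨ trans (⊗-resp-≈ (sym F.F-id) (ext-∘SM (b ∷ A))) split₂ʳ ⟩
      F.F₁ (G.F₁ (cons a b A)) ∘ F.F₁ G.φ ∘ F.φ ∘ (F.F₁ C.id ⊗₁ F.F₁ (I.ext (b ∷ A))) ∘ (id ⊗₁ φext I.obj (b ∷ A))
        ≈⟨ refl⟩∘⟨ refl⟩∘⟨ trans (pullˡ F.φ-natural) assoc ⟩
      F.F₁ (G.F₁ (cons a b A)) ∘ F.F₁ G.φ ∘ F.F₁ (C.id C.⊗₁ I.ext (b ∷ A)) ∘ F.φ ∘ (id ⊗₁ φext I.obj (b ∷ A))
        ≈⟨ trans (sym assoc²') (sym F.F-∘₃ ⟩∘⟨refl) ⟩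
      F.F₁ (I.ext (a ∷ b ∷ A)) ∘ F.φ ∘ (id ⊗₁ φext I.obj (b ∷ A)) ∎

    φext-isoʳ : ∀ A → φext I.obj A ∘ φext⁻¹ I.obj A ≈ id
    φext-isoʳ [] = F.ε-isoʳ
    φext-isoʳ (a ∷ []) = identityˡ
    φext-isoʳ (a ∷ b ∷ A) = ∘-inverse F.φ-isoʳ (⊗-inverse identityˡ (φext-isoʳ (b ∷ A)))

    ext⁻¹-∘SM : ∀ A → FI.ext⁻¹ A ≈ φext⁻¹ I.obj A ∘ F.F₁ (I.ext⁻¹ A)
    ext⁻¹-∘SM A =
      inverse-unique (ext-∘SM A) (FI.ext-isoˡ A) (∘-inverse (F.F-inverse (I.ext-isoʳ A)) (φext-isoʳ A))

    transfer-∘SM : ∀ {A B} (f : Mor ⌜ A ⌝ ⌜ B ⌝) →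
                   FI.transfer f ≈ φext⁻¹ I.obj B ∘ F.F₁ (I.transfer f) ∘ φext I.obj A
    transfer-∘SM {A} {B} f = begin
      FI.ext⁻¹ B ∘ F.F₁ (G.F₁ f) ∘ FI.ext A
        ≈⟨ ext⁻¹-∘SM B ⟩∘⟨ refl⟩∘⟨ ext-∘SM A ⟩
      (φext⁻¹ I.obj B ∘ F.F₁ (I.ext⁻¹ B)) ∘ F.F₁ (G.F₁ f) ∘ F.F₁ (I.ext A) ∘ φext I.obj A
        ≈⟨ assoc ⟩
      φext⁻¹ I.obj B ∘ F.F₁ (I.ext⁻¹ B) ∘ F.F₁ (G.F₁ f) ∘ F.F₁ (I.ext A) ∘ φext I.obj A
        ≈⟨ refl⟩∘⟨ trans (sym assoc²') (sym F.F-∘₃ ⟩∘⟨refl) ⟩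
      φext⁻¹ I.obj B ∘ F.F₁ (I.transfer f) ∘ φext I.obj A ∎

    ⟦transport⟧≈⟦∘SM⟧ : ∀ {x A t B} (d : Der x A t B) → Interp.⟦_⟧d (transport I.pre) d ≈ FI.⟦ d ⟧d
    ⟦transport⟧≈⟦∘SM⟧ = ⟦⟧-resp-operations D (transport I.pre)
      (λ f → trans (sym identityˡ) (sym (transfer-∘SM (⌜fn⌝ f))))
      (λ w A → sym (transfer-∘SM (⌜π⌝ w A)))
      (λ w A s → sym (transfer-∘SM (⌜σ⌝ w A s)))
      (λ w A → sym (transfer-∘SM (⌜Δ⌝ w A)))

    transport-iso : PreIso (transport I.pre) FI.pre
    transport-iso = record
      { to = record { h = λ a → id ; commute = identity-commutes D ⟦transport⟧≈⟦∘SM⟧ }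
      ; from = record { h = λ a → id ; commute = identity-commutes D (λ d → sym (⟦transport⟧≈⟦∘SM⟧ d)) }
      ; isoˡ = λ a → identityˡ
      ; isoʳ = λ a → identityˡ
      }

  pseudoNatural : PseudoNatural Th equivalence
  pseudoNatural = record
    { iso = transport-iso
    ; iso-natural = λ {D = D} _ _ _ → MonoidalReasoning.id-comm-sym D
    ; iso-2cell = λ {D = D} _ _ _ → MonoidalReasoning.id-comm-sym D
    }

theorem4p3 : (Th : Theory) → ClassifyingCategory Th
theorem4p3 Th = record { 𝐓 = 𝐓 Th ; equivalence = equivalence Th ; natural = pseudoNatural Th }
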